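{- Let $\alpha \in \mathbb{Z}$ be such that both $\alpha - 8$ and $\alpha + 8$ are squarefree. Let $f_\alpha(T) = T^4 - 6T^2 - \alpha T - 3 \in \mathbb{Z}[T]$. Then $f_\alpha$ is irreducible over $\mathbb{Q}$, and if $\theta$ is a root of $f_\alpha$ and $K_\alpha = \mathbb{Q}(\theta)$, then the ring of integers of $K_\alpha$ is $\mathbb{Z}[\theta]$; in particular $K_\alpha$ is a monogenic quartic field.
   Context: An integer $m$ is squarefree if $p^2 \nmid m$ for every prime $p$ (negative integers allowed). -}

module Defs where

open import Data.Nat as ℕ using (ℕ; zero; suc)
open import Data.Nat.Primality using (Prime)
open import Data.Integer as ℤ using (ℤ; +_)
open import Data.Integer.Divisibility using (_∣_)
open import Data.Rational as ℚ using (ℚ; 0ℚ; 1ℚ)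
open import Data.List using (List; []; _∷_; map; _++_; [_])
open import Data.Product using (∃; ∃-syntax; _×_)
open import Relation.Binary.PropositionalEquality using (_≡_; _≢_)
open import Relation.Nullary using (¬_)
open import Data.Sum using (_⊎_)

SquareFree : ℤ → Set
SquareFree m = ∀ (p : ℕ) → Prime p → ¬ ((+ p ℤ.* + p) ∣ m)

ℤ→ℚ : ℤ → ℚ
ℤ→ℚ z = z ℚ./ 1

-- Polynomials over ℚ as coefficient lists, constant term first.
Poly : Set
Poly = List ℚ

coeff : Poly → ℕ → ℚ
coeff []       _       = 0ℚ
coeff (a ∷ p)  zero    = a
coeff (a ∷ p)  (suc k) = coeff p k

-- Equality of polynomials: equal coefficients (ignores trailing zeros).
_≈ₚ_ : Poly → Poly → Set
p ≈ₚ q = ∀ k → coeff p k ≡ coeff q k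

infixl 6 _+ₚ_ _-ₚ_
infixl 7 _*ₚ_

_+ₚ_ : Poly → Poly → Poly
[]      +ₚ q       = q
(a ∷ p) +ₚ []      = a ∷ p
(a ∷ p) +ₚ (b ∷ q) = (a ℚ.+ b) ∷ (p +ₚ q)

negₚ : Poly → Poly
negₚ = map (λ a → ℚ.- a)

_-ₚ_ : Poly → Poly → Poly
p -ₚ q = p +ₚ negₚ q

scale : ℚ → Poly → Poly
scale a = map (a ℚ.*_)

_*ₚ_ : Poly → Poly → Poly
[]      *ₚ q = []
(a ∷ p) *ₚ q = scale a q +ₚ (0ℚ ∷ (p *ₚ q))

compose : Poly → Poly → Poly
compose []      x = []
compose (c ∷ g) x = [ c ] +ₚ (x *ₚ compose g x)

ℤPoly→Poly : List ℤ → Poly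
ℤPoly→Poly = map ℤ→ℚ

NonConstant : Poly → Set
NonConstant p = ∃[ k ] (coeff p (suc k) ≢ 0ℚ)

-- Irreducible in ℚ[T]: non-zero, non-unit, and every factorisation has a unit factor
-- (units of ℚ[T] are the nonzero constants).
IrreducibleOverℚ : Poly → Set
IrreducibleOverℚ f =
  ¬ (∀ k → coeff f k ≡ 0ℚ) × NonConstant f ×
  (∀ g h → f ≈ₚ (g *ₚ h) → ¬ NonConstant g ⊎ ¬ NonConstant h)

_∣ₚ_ : Poly → Poly → Set
f ∣ₚ p = ∃[ q ] (p ≈ₚ (f *ₚ q))

-- The field K = ℚ(θ) ≅ ℚ[T]/(f) for f irreducible, θ = class of T.
-- An element x ∈ K (represented by a polynomial in θ) is integral over ℤ if it is a
-- root of a monic integer polynomial  cs ++ [1],  i.e. f ∣ g(x) in ℚ[T].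
IntegralMod : Poly → Poly → Set
IntegralMod f x = ∃[ cs ] (f ∣ₚ compose (ℤPoly→Poly (cs ++ [ + 1 ])) x)

InℤAdjoinMod : Poly → Poly → Set
InℤAdjoinMod f x = ∃[ y ] (f ∣ₚ (x -ₚ ℤPoly→Poly y))

RingOfIntegersIsℤ[θ] : Poly → Set
RingOfIntegersIsℤ[θ] f =
  ∀ (x : Poly) → (IntegralMod f x → InℤAdjoinMod f x) × (InℤAdjoinMod f x → IntegralMod f x)

fα : ℤ → Poly
fα α = ℤPoly→Poly (ℤ.- (+ 3) ∷ ℤ.- α ∷ ℤ.- (+ 6) ∷ + 0 ∷ + 1 ∷ [])

{-# OPTIONS --safe #-}

-- Let v ∈ ℤ[θ] with v / p integral. If s, u ∈ ℤ[θ] satisfy s v = p u, then multiplying a monic equation of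
-- v / p by a power of s shows that s divides a power of u, so every prime ideal containing s contains u.
--
-- Since f = (T − 1)³(T + 3) − (α + 8) T = (T + 1)³(T − 3) − (α − 8) T, for p ∣ α ± 8 (and similarly for p = 3 ∣ α,
-- where f ≡ T⁴) there is a relation S³ S′ = p g in ℤ[θ], and by squarefreeness g avoids the prime (p, S). The
-- choices s = p, S² S′, S S′, S′ then show in turn that v ∈ (p, S), (p, S²), (p, S³), (p, S³ S′) = (p). For all other
-- p the derivative f′(θ) is invertible modulo p, so ℤ[θ]/p is reduced, and s = p shows that v is nilpotent in it.
-- Hence denominators of integral elements can be removed one prime at a time.
--
-- For irreducibility, a rational root of f is an integer dividing 3, and if T² + aT + b divides f then a and b
-- are integers with b ∣ 3 and (a² − 4)³ = α² − 64; both only happen for α = ± 8.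

module Submission where

open import Defs
open import Algebra.Bundles using (CommutativeRing)
open import Algebra.Consequences.Propositional using (comm∧distrʳ⇒distrˡ; comm∧idˡ⇒id; comm∧invˡ⇒inv)
import Algebra.Morphism.Construct.Identity as Identity
open import Algebra.Morphism.Structures using (IsRingHomomorphism; IsRingMonomorphism)
import Algebra.Properties.Group as GroupProperties
import Algebra.Properties.Ring as RingProperties
import Algebra.Properties.Semiring.Exp as Exponentiation
import Algebra.Properties.Semiring.Sum as Summation
import Algebra.Solver.Ring as RingSolver
open import Algebra.Solver.Ring.AlmostCommutativeRing using (fromCommutativeRing; _-Raw-AlmostCommutative⟶_)
import Algebra.Solver.Ring.NaturalCoefficients.Default as NaturalSolver
open import Algebra.Structures using (IsCommutativeRing)
open import Data.Empty using (⊥-elim)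
open import Data.Fin using (Fin; fromℕ) renaming (zero to fzero; suc to fsuc)
import Data.Fin.Properties as Fin
open import Data.Integer as ℤ using (ℤ; +_)
import Data.Integer.DivMod as ℤ
open import Data.Integer.Divisibility.Signed as Signed using (divides)
import Data.Integer.Properties as ℤ
import Data.Integer.Solver as ℤ
open import Data.List using (List; []; _∷_; [_]; _++_; foldr; length)
open import Data.List.Relation.Unary.All using (All; []; _∷_)
open import Data.Maybe as Maybe using (Maybe)
open import Data.Nat as ℕ using (ℕ; zero; suc)
import Data.Nat.Coprimality as Coprimality
import Data.Nat.Divisibility as ℕ
open import Data.Nat.ListAction using (product)
open import Data.Nat.Primality using (Prime; euclidsLemma; ¬prime[1]; prime?; prime⇒irreducible; prime⇒nonZero)
open import Data.Nat.Primality.Factorisation using (factorise; module PrimeFactorisation)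
import Data.Nat.Properties as ℕ
open import Data.Product using (_×_; _,_; ∃-syntax; proj₁; proj₂)
open import Data.Rational as ℚ using (ℚ; 0ℚ; 1ℚ)
import Data.Rational.Properties as ℚ
open import Data.Rational.Unnormalised as ℚᵘ using (mkℚᵘ; *≡*)
import Data.Rational.Unnormalised.Properties as ℚᵘ
open import Data.Sum as Sum using (_⊎_; inj₁; inj₂)
open import Function using (_∘_; id)
open import Level using (0ℓ)
open import Relation.Binary.Consequences using (dec⇒weaklyDec)
open import Relation.Binary.PropositionalEquality as ≡ using (_≡_; _≢_)
import Relation.Binary.Reasoning.Setoid as SetoidReasoning
open import Relation.Nullary using (¬_; yes; no)
open import Relation.Nullary.Decidable using (from-yes)

-- Integrality in commutative rings

-- The discriminant of f is -27 (α² - 64)², so a criterion asking for a squarefree discriminant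
-- never applies, and each prime dividing it needs an argument of its own. The centres ±1 come from
-- f″ = 12 (T² - 1), whose zeros are the candidates for triple roots: f(1) = f′(1) = -(α + 8) and
-- f″(1) = 0, so 1 is a triple root modulo every divisor of α + 8, and likewise -1 for α - 8. The
-- remaining root is ∓3 because f has no cubic term. Factorisation of ideals cannot be assumed in an
-- order not yet known to be maximal. The argument relies only on the primality of explicit ideals
-- (p, θ - τ) with residue field 𝔽_p, where membership of v is divisibility of the integer v(τ) by
-- p. The converse inclusion asks for a monic integer equation for every element of ℤ[θ]; it comes
-- from the matrix of multiplication by that element.

module _ (R : CommutativeRing 0ℓ 0ℓ) where
  open CommutativeRing R

  evalAt : (ℤ → Carrier) → List ℤ → Carrier → Carrier
  evalAt j cs x = foldr (λ c e → j c + x * e) 0# cs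

module _ (A K : CommutativeRing 0ℓ 0ℓ) where
  private
    module A = CommutativeRing A
    module K = CommutativeRing K

  evalAt-homo : ∀ {ι} → IsRingHomomorphism A.rawRing K.rawRing ι → ∀ j cs x → evalAt K (λ c → ι (j c)) cs (ι x) K.≈ ι (evalAt A j cs x)
  evalAt-homo ι-homo j []       x = K.sym (IsRingHomomorphism.0#-homo ι-homo)
  evalAt-homo ι-homo j (c ∷ cs) x = K.trans (K.+-congˡ (K.trans (K.*-congˡ (evalAt-homo ι-homo j cs x)) (K.sym (*-homo _ _))))
    (K.sym (+-homo _ _))
    where open IsRingHomomorphism ι-homo

module Integrality (A K : CommutativeRing 0ℓ 0ℓ) where
  private
    module A = CommutativeRing A
    module K = CommutativeRing K
  open Exponentiation A.semiring using (_^_)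

  module _ {ι : A.Carrier → K.Carrier} (mono : IsRingMonomorphism A.rawRing K.rawRing ι)
           {j : ℤ → A.Carrier} (j1≈1 : j (+ 1) A.≈ A.1#) where
    open IsRingMonomorphism mono
    module SolverA = NaturalSolver A.commutativeSemiring
    open NaturalSolver K.commutativeSemiring using (solve; _:+_; _:*_; _:=_)

    -- Multiplying a monic equation of degree n for w by sⁿ gives one for s w over A.
    clear-denominator : ∀ {s u w} → ι s K.* w K.≈ ι u → ∀ cs → ∃[ t ]
      ι (s ^ length cs) K.* evalAt K (λ c → ι (j c)) (cs ++ [ + 1 ]) w K.≈ ι (u ^ length cs A.+ s A.* t)
    clear-denominator {s} {u} {w} sw≈u [] = A.0# , (begin
      ι A.1# K.* (ι (j (+ 1)) K.+ w K.* K.0#) ≈⟨ K.*-cong 1#-homo (K.+-cong (⟦⟧-cong j1≈1) (K.zeroʳ w)) ⟩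
      K.1# K.* (ι A.1# K.+ K.0#)              ≈⟨ K.*-identityˡ _ ⟩
      ι A.1# K.+ K.0#                         ≈⟨ K.+-identityʳ _ ⟩
      ι A.1#                                  ≈⟨ ⟦⟧-cong (A.+-identityʳ _) ⟨
      ι (A.1# A.+ A.0#)                       ≈⟨ ⟦⟧-cong (A.+-congˡ (A.zeroʳ s)) ⟨
      ι (A.1# A.+ s A.* A.0#)                 ∎)
      where open SetoidReasoning K.setoid
    clear-denominator {s} {u} {w} sw≈u (c ∷ cs) with clear-denominator {s} {u} {w} sw≈u cs
    ... | t , ih = sⁿ A.* j c A.+ u A.* t , (begin
      ι (s A.* sⁿ) K.* (ι (j c) K.+ w K.* e)
        ≈⟨ K.*-congʳ (*-homo s sⁿ) ⟩
      ι s K.* ι sⁿ K.* (ι (j c) K.+ w K.* e)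
        ≈⟨ solve 5 (λ s sⁿ c w e → s :* sⁿ :* (c :+ w :* e) := (s :* w) :* (sⁿ :* e) :+ s :* (sⁿ :* c)) K.refl _ _ _ _ _ ⟩
      (ι s K.* w) K.* (ι sⁿ K.* e) K.+ ι s K.* (ι sⁿ K.* ι (j c))
        ≈⟨ K.+-cong (K.*-cong sw≈u ih) (K.*-congˡ (K.sym (*-homo sⁿ (j c)))) ⟩
      ι u K.* ι (uⁿ A.+ s A.* t) K.+ ι s K.* ι (sⁿ A.* j c)
        ≈⟨ K.+-cong (*-homo u _) (*-homo s _) ⟨
      ι (u A.* (uⁿ A.+ s A.* t)) K.+ ι (s A.* (sⁿ A.* j c))
        ≈⟨ +-homo _ _ ⟨
      ι (u A.* (uⁿ A.+ s A.* t) A.+ s A.* (sⁿ A.* j c))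
        ≈⟨ ⟦⟧-cong (rearrange u uⁿ s t (sⁿ A.* j c)) ⟩
      ι (u A.* uⁿ A.+ s A.* (sⁿ A.* j c A.+ u A.* t)) ∎)
      where
      open SetoidReasoning K.setoid
      sⁿ = s ^ length cs
      uⁿ = u ^ length cs
      e = evalAt K (λ c → ι (j c)) (cs ++ [ + 1 ]) w
      rearrange : ∀ u uⁿ s t x → u A.* (uⁿ A.+ s A.* t) A.+ s A.* x A.≈ u A.* uⁿ A.+ s A.* (x A.+ u A.* t)
      rearrange = SolverA.solve 5 (λ u uⁿ s t x → u ⊗ (uⁿ ⊕ s ⊗ t) ⊕ s ⊗ x SolverA.:=
          u ⊗ uⁿ ⊕ s ⊗ (x ⊕ u ⊗ t)) A.refl
        where open SolverA using () renaming (_:+_ to infixl 6 _⊕_; _:*_ to infixl 7 _⊗_)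

    -- Injectivity of ι brings the cleared equation back to `A`. Over ℤ this yields the rational
    -- root theorem, over ℤ[θ] the condition `IntegralQuotient`.
    integral⇒∣power : ∀ {s u w cs} → ι s K.* w K.≈ ι u →
      evalAt K (λ c → ι (j c)) (cs ++ [ + 1 ]) w K.≈ K.0# → ∃[ n ] ∃[ t ] u ^ n A.≈ s A.* t
    integral⇒∣power {s} {u} {w} {cs} sw≈u root with clear-denominator sw≈u cs
    ... | t , eq = length cs , A.- t , (begin
      u ^ length cs        ≈⟨ +-inverseˡ-unique _ _ uⁿ+st≈0 ⟩
      A.- (s A.* t)        ≈⟨ -‿distribʳ-* s t ⟩
      s A.* (A.- t)        ∎)
      where
      open SetoidReasoning A.setoid
      open RingProperties A.ring using (-‿distribʳ-*; +-inverseˡ-unique)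
      uⁿ+st≈0 : u ^ length cs A.+ s A.* t A.≈ A.0#
      uⁿ+st≈0 = injective (K.trans (K.sym eq) (K.trans (K.trans (K.*-congˡ root) (K.zeroʳ _)) (K.sym 0#-homo)))

-- The determinant trick by elimination

module Elimination (A : CommutativeRing 0ℓ 0ℓ) {j : ℤ → CommutativeRing.Carrier A}
  (j-homo : IsRingHomomorphism ℤ.+-*-rawRing (CommutativeRing.rawRing A) j) (x : CommutativeRing.Carrier A) where

  open CommutativeRing A
  open IsRingHomomorphism j-homo
  open NaturalSolver commutativeSemiring using (solve; _:+_; _:*_; _:=_; con)
  open Summation semiring using (sum; *-distribˡ-sum; ∑-distrib-+; sum-cong-≋; sum-replicate-zero)

  -- Values at x of integer polynomials of degree < d, and of monic ones of degree d.
  data Low : ℕ → Carrier → Set where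
    low-zero : ∀ {a} → a ≈ 0# → Low 0 a
    low-suc  : ∀ {d a} c b → a ≈ j c + x * b → Low d b → Low (suc d) a

  data Monic : ℕ → Carrier → Set where
    monic-zero : ∀ {a} → a ≈ 1# → Monic 0 a
    monic-suc  : ∀ {d a} c b → a ≈ j c + x * b → Monic d b → Monic (suc d) a

  low-resp-≈ : ∀ {d a b} → a ≈ b → Low d a → Low d b
  low-resp-≈ a≈b (low-zero a≈0)        = low-zero (trans (sym a≈b) a≈0)
  low-resp-≈ a≈b (low-suc c a′ a≈ low) = low-suc c a′ (trans (sym a≈b) a≈) low

  monic-resp-≈ : ∀ {d a b} → a ≈ b → Monic d a → Monic d b
  monic-resp-≈ a≈b (monic-zero a≈1)          = monic-zero (trans (sym a≈b) a≈1)
  monic-resp-≈ a≈b (monic-suc c a′ a≈ monic) = monic-suc c a′ (trans (sym a≈b) a≈) monic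

  low-x* : ∀ {d a} → Low d a → Low (suc d) (x * a)
  low-x* {a = a} low = low-suc (+ 0) a (trans (sym (+-identityˡ _)) (+-congʳ (sym 0#-homo))) low

  monic-x* : ∀ {d a} → Monic d a → Monic (suc d) (x * a)
  monic-x* {a = a} monic = monic-suc (+ 0) a (trans (sym (+-identityˡ _)) (+-congʳ (sym 0#-homo))) monic

  low-0 : ∀ d → Low d 0#
  low-0 zero    = low-zero refl
  low-0 (suc d) = low-resp-≈ (zeroʳ x) (low-x* (low-0 d))

  low-suc-weaken : ∀ {d a} → Low d a → Low (suc d) a
  low-suc-weaken (low-zero a≈0)       = low-resp-≈ (sym a≈0) (low-0 1)
  low-suc-weaken (low-suc c b a≈ low) = low-suc c b a≈ (low-suc-weaken low)

  low-weaken : ∀ k {d a} → Low d a → Low (k ℕ.+ d) a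
  low-weaken zero    low = low
  low-weaken (suc k) low = low-suc-weaken (low-weaken k low)

  regroup : ∀ c b c′ b′ → (j c + x * b) + (j c′ + x * b′) ≈ j (c ℤ.+ c′) + x * (b + b′)
  regroup c b c′ b′ = trans (solve 5 (λ c x b c′ b′ → (c :+ x :* b) :+ (c′ :+ x :* b′) := (c :+ c′) :+ x :* (b :+ b′)) refl _ x b _ b′)
    (+-congʳ (sym (+-homo c c′)))

  low-+ : ∀ {d a b} → Low d a → Low d b → Low d (a + b)
  low-+ (low-zero a≈0) (low-zero b≈0) = low-zero (trans (+-cong a≈0 b≈0) (+-identityˡ 0#))
  low-+ (low-suc c a′ a≈ low) (low-suc c′ b′ b≈ low′) =
    low-suc (c ℤ.+ c′) (a′ + b′) (trans (+-cong a≈ b≈) (regroup c a′ c′ b′)) (low-+ low low′)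

  monic-+ : ∀ {d a b} → Monic d a → Low d b → Monic d (a + b)
  monic-+ (monic-zero a≈1) (low-zero b≈0) = monic-zero (trans (+-cong a≈1 b≈0) (+-identityʳ 1#))
  monic-+ (monic-suc c a′ a≈ monic) (low-suc c′ b′ b≈ low) =
    monic-suc (c ℤ.+ c′) (a′ + b′) (trans (+-cong a≈ b≈) (regroup c a′ c′ b′)) (monic-+ monic low)

  scale-expand : ∀ k {c a b} → a ≈ j c + x * b → j k * a ≈ j (k ℤ.* c) + x * (j k * b)
  scale-expand k {c} {a} {b} a≈ = trans (*-congˡ a≈)
    (trans (solve 4 (λ k c x b → k :* (c :+ x :* b) := k :* c :+ x :* (k :* b)) refl (j k) (j c) x b) (+-congʳ (sym (*-homo k c))))

  low-scale : ∀ k {d a} → Low d a → Low d (j k * a)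
  low-scale k (low-zero a≈0)       = low-zero (trans (*-congˡ a≈0) (zeroʳ _))
  low-scale k (low-suc c b a≈ low) = low-suc (k ℤ.* c) (j k * b) (scale-expand k a≈) (low-scale k low)

  low-neg : ∀ {d a} → Low d a → Low d (- a)
  low-neg {a = a} low = low-resp-≈ (trans (*-congʳ (trans (-‿homo (+ 1)) (-‿cong 1#-homo))) (RingProperties.-1*x≈-x ring a))
    (low-scale (ℤ.- (+ 1)) low)

  monic⇒low : ∀ {d a} → Monic d a → Low (suc d) a
  monic⇒low (monic-zero a≈1)         = low-suc (+ 1) 0#
    (trans a≈1 (trans (sym 1#-homo) (sym (trans (+-congˡ (zeroʳ x)) (+-identityʳ _))))) (low-zero refl)
  monic⇒low (monic-suc c b a≈ monic) = low-suc c b a≈ (monic⇒low monic)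

  expand-* : ∀ {a c a′} b → a ≈ j c + x * a′ → x * (a′ * b) + j c * b ≈ a * b
  expand-* {a} {c} {a′} b a≈ = trans (solve 4 (λ c x a b → x :* (a :* b) :+ c :* b := (c :+ x :* a) :* b) refl (j c) x a′ b)
    (*-congʳ (sym a≈))

  low-* : ∀ {d e a b} → Low d a → Low e b → Low (d ℕ.+ e) (a * b)
  low-* {e = e} {b = b} (low-zero a≈0) low-b = low-resp-≈ (sym (trans (*-congʳ a≈0) (zeroˡ b))) (low-0 e)
  low-* {suc d} {e} {b = b} (low-suc c a′ a≈ low-a) low-b = low-resp-≈ (expand-* b a≈)
    (low-+ (low-x* (low-* low-a low-b)) (low-weaken (suc d) (low-scale c low-b)))

  scaled-monic-low : ∀ d c {e b} → Monic e b → Low (suc (d ℕ.+ e)) (j c * b)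
  scaled-monic-low d c {e} {b} monic = ≡.subst (λ n → Low n (j c * b)) (ℕ.+-suc d e) (low-weaken d (low-scale c (monic⇒low monic)))

  -- Sharper by one than `monic⇒low` followed by `low-*`. Elimination needs this: a pivot times an
  -- off-diagonal entry must stay below the degree d + d of the new monic diagonal.
  low-*-monic : ∀ {d e a b} → Low d a → Monic e b → Low (d ℕ.+ e) (a * b)
  low-*-monic {e = e} {b = b} (low-zero a≈0) monic-b = low-resp-≈ (sym (trans (*-congʳ a≈0) (zeroˡ b))) (low-0 e)
  low-*-monic {suc d} {b = b} (low-suc c a′ a≈ low-a) monic-b = low-resp-≈ (expand-* b a≈)
    (low-+ (low-x* (low-*-monic low-a monic-b)) (scaled-monic-low d c monic-b))

  monic-* : ∀ {d e a b} → Monic d a → Monic e b → Monic (d ℕ.+ e) (a * b)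
  monic-* {b = b} (monic-zero a≈1) monic-b = monic-resp-≈ (sym (trans (*-congʳ a≈1) (*-identityˡ b))) monic-b
  monic-* {suc d} {b = b} (monic-suc c a′ a≈ monic-a) monic-b = monic-resp-≈ (expand-* b a≈)
    (monic-+ (monic-x* (monic-* monic-a monic-b)) (scaled-monic-low d c monic-b))

  -- Gaussian elimination without division keeps monic entries on the diagonal that dominate all others, so the
  -- determinant trick needs no determinants.
  eliminate : ∀ n (B : Fin (suc n) → Fin (suc n) → Carrier) (z : Fin (suc n) → Carrier) d →
    (∀ i → Monic d (B i i)) → (∀ i k → i ≢ k → Low d (B i k)) → (∀ i → sum (λ k → B i k * z k) ≈ 0#) →
    ∃[ e ] ∃[ b ] Monic e b × b * z (fromℕ n) ≈ 0#
  eliminate zero    B z d diagonal off-diagonal Bz≈0 =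
    d , B fzero fzero , diagonal fzero , trans (sym (+-identityʳ _)) (Bz≈0 fzero)
  eliminate (suc n) B z d diagonal off-diagonal Bz≈0 = eliminate n B′ (z ∘ fsuc) (d ℕ.+ d)
      (λ i → monic-+ (monic-* (diagonal fzero) (diagonal (fsuc i)))
                     (low-* (low-neg (off-diagonal (fsuc i) fzero λ ())) (off-diagonal fzero (fsuc i) λ ())))
      (λ i k i≢k → low-+ (low-resp-≈ (*-comm _ _)
        (low-*-monic (off-diagonal (fsuc i) (fsuc k) (i≢k ∘ Fin.suc-injective)) (diagonal fzero)))
                     (low-* (low-neg (off-diagonal (fsuc i) fzero λ ())) (off-diagonal fzero (fsuc k) λ ())))
      B′z≈0
    where
    B₀₀ = B fzero fzero
    B′ : Fin (suc n) → Fin (suc n) → Carrier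
    B′ i k = B₀₀ * B (fsuc i) (fsuc k) + - B (fsuc i) fzero * B fzero (fsuc k)
    B′z≈0 : ∀ i → sum (λ k → B′ i k * z (fsuc k)) ≈ 0#
    B′z≈0 i = begin
      sum (λ k → B′ i k * z (fsuc k))
        ≈⟨ sum-cong-≋ (λ k → solve 5 (λ p q r s z → (p :* q :+ r :* s) :* z := p :* (q :* z) :+ r :* (s :* z)) refl
             B₀₀ (B (fsuc i) (fsuc k)) (- Bᵢ₀) (B fzero (fsuc k)) (z (fsuc k))) ⟩
      sum (λ k → B₀₀ * (B (fsuc i) (fsuc k) * z (fsuc k)) + - Bᵢ₀ * (B fzero (fsuc k) * z (fsuc k)))
        ≈⟨ ∑-distrib-+ (λ k → B₀₀ * (B (fsuc i) (fsuc k) * z (fsuc k))) (λ k → - Bᵢ₀ * (B fzero (fsuc k) * z (fsuc k))) ⟩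
      sum (λ k → B₀₀ * (B (fsuc i) (fsuc k) * z (fsuc k))) + sum (λ k → - Bᵢ₀ * (B fzero (fsuc k) * z (fsuc k)))
        ≈⟨ +-cong (*-distribˡ-sum B₀₀ (λ k → B (fsuc i) (fsuc k) * z (fsuc k)))
                   (*-distribˡ-sum (- Bᵢ₀) (λ k → B fzero (fsuc k) * z (fsuc k))) ⟨
      B₀₀ * rowᵢ + - Bᵢ₀ * row₀
        ≈⟨ +-identityˡ _ ⟨
      0# + (B₀₀ * rowᵢ + - Bᵢ₀ * row₀)
        ≈⟨ +-congʳ (trans (*-congʳ (-‿inverseʳ Bᵢ₀)) (zeroˡ _)) ⟨
      -- The column of the pivot has cancelled; putting it back as zero completes both rows, which
      -- vanish by assumption.
      (Bᵢ₀ + - Bᵢ₀) * (B₀₀ * z fzero) + (B₀₀ * rowᵢ + - Bᵢ₀ * row₀)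
        ≈⟨ solve 6 (λ p q m z s t → (q :+ m) :* (p :* z) :+ (p :* s :+ m :* t) := p :* (q :* z :+ s) :+ m :* (p :* z :+ t)) refl
             B₀₀ Bᵢ₀ (- Bᵢ₀) (z fzero) rowᵢ row₀ ⟩
      B₀₀ * (Bᵢ₀ * z fzero + rowᵢ) + - Bᵢ₀ * (B₀₀ * z fzero + row₀)
        ≈⟨ +-cong (trans (*-congˡ (Bz≈0 (fsuc i))) (zeroʳ B₀₀)) (trans (*-congˡ (Bz≈0 fzero)) (zeroʳ (- Bᵢ₀))) ⟩
      0# + 0#
        ≈⟨ +-identityˡ 0# ⟩
      0# ∎
      where
      open SetoidReasoning setoid
      Bᵢ₀ = B (fsuc i) fzero
      rowᵢ = sum (λ k → B (fsuc i) (fsuc k) * z (fsuc k))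
      row₀ = sum (λ k → B fzero (fsuc k) * z (fsuc k))

  monic⇒evalAt : ∀ {d b} → Monic d b → ∃[ cs ] evalAt A j (cs ++ [ + 1 ]) x ≈ b
  monic⇒evalAt (monic-zero b≈1) = [] , trans (+-cong 1#-homo (zeroʳ x)) (trans (+-identityʳ 1#) (sym b≈1))
  monic⇒evalAt (monic-suc c b a≈ monic) = let cs , eq = monic⇒evalAt monic in
    c ∷ cs , trans (+-congˡ (*-congˡ eq)) (sym a≈)

  scalarMatrix : ∀ {n} → Fin n → Fin n → Carrier
  scalarMatrix fzero    fzero    = x
  scalarMatrix fzero    (fsuc k) = 0#
  scalarMatrix (fsuc i) fzero    = 0#
  scalarMatrix (fsuc i) (fsuc k) = scalarMatrix i k

  scalarMatrix-diagonal : ∀ {n} (i : Fin n) → scalarMatrix i i ≡ x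
  scalarMatrix-diagonal fzero    = ≡.refl
  scalarMatrix-diagonal (fsuc i) = scalarMatrix-diagonal i

  scalarMatrix-off-diagonal : ∀ {n} (i k : Fin n) → i ≢ k → scalarMatrix i k ≡ 0#
  scalarMatrix-off-diagonal fzero    fzero    i≢k = ⊥-elim (i≢k ≡.refl)
  scalarMatrix-off-diagonal fzero    (fsuc k) i≢k = ≡.refl
  scalarMatrix-off-diagonal (fsuc i) fzero    i≢k = ≡.refl
  scalarMatrix-off-diagonal (fsuc i) (fsuc k) i≢k = scalarMatrix-off-diagonal i k (i≢k ∘ ≡.cong fsuc)

  scalarMatrix-* : ∀ {n} (z : Fin n → Carrier) i → sum (λ k → scalarMatrix i k * z k) ≈ x * z i
  scalarMatrix-* {suc n} z fzero    = trans (+-congˡ (trans (sum-cong-≋ (λ k → zeroˡ (z (fsuc k)))) (sum-replicate-zero n)))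
    (+-identityʳ _)
  scalarMatrix-* {suc n} z (fsuc i) = trans (+-cong (zeroˡ (z fzero)) (scalarMatrix-* (z ∘ fsuc) i)) (+-identityˡ _)

  -- The determinant trick; M is minus the matrix of x, so that x + M annihilates z.
  matrix⇒integral : ∀ n (z : Fin (suc n) → Carrier) (M : Fin (suc n) → Fin (suc n) → ℤ) → z (fromℕ n) ≈ 1# →
    (∀ i → sum (λ k → j (M i k) * z k) ≈ - (x * z i)) → ∃[ cs ] evalAt A j (cs ++ [ + 1 ]) x ≈ 0#
  matrix⇒integral n z M z≈1 action =
    let e , b , monic , bz≈0 = eliminate n B z 1 diagonal off-diagonal row
        cs , eq = monic⇒evalAt monic
    in cs , trans eq (trans (sym (*-identityʳ b)) (trans (*-congˡ (sym z≈1)) bz≈0))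
    where
    B : Fin (suc n) → Fin (suc n) → Carrier
    B i k = scalarMatrix i k + j (M i k)
    diagonal : ∀ i → Monic 1 (B i i)
    diagonal i = monic-suc (M i i) 1#
      (trans (+-comm _ _) (+-congˡ (trans (reflexive (scalarMatrix-diagonal i)) (sym (*-identityʳ x))))) (monic-zero refl)
    off-diagonal : ∀ i k → i ≢ k → Low 1 (B i k)
    off-diagonal i k i≢k = low-suc (M i k) 0#
      (trans (+-comm _ _) (+-congˡ (trans (reflexive (scalarMatrix-off-diagonal i k i≢k)) (sym (zeroʳ x))))) (low-zero refl)
    row : ∀ i → sum (λ k → B i k * z k) ≈ 0#
    row i = begin
      sum (λ k → B i k * z k)
        ≈⟨ sum-cong-≋ (λ k → distribʳ (z k) (scalarMatrix i k) (j (M i k))) ⟩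
      sum (λ k → scalarMatrix i k * z k + j (M i k) * z k)
        ≈⟨ ∑-distrib-+ (λ k → scalarMatrix i k * z k) (λ k → j (M i k) * z k) ⟩
      sum (λ k → scalarMatrix i k * z k) + sum (λ k → j (M i k) * z k)
        ≈⟨ +-cong (scalarMatrix-* z i) (action i) ⟩
      x * z i + - (x * z i)
        ≈⟨ -‿inverseʳ (x * z i) ⟩
      0# ∎
      where open SetoidReasoning setoid

-- A local criterion for divisibility by π

module LocalCriterion (A : CommutativeRing 0ℓ 0ℓ) where
  open CommutativeRing A
  open Exponentiation semiring using (_^_)
  open NaturalSolver commutativeSemiring using (solve; _:+_; _:*_; _:=_; con)

  -- Closure under sums takes the form of cancellation, as it is applied; `∈-*ʳ` with the factor -1
  -- recovers the usual form.
  record PrimeIdeal : Set₁ where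
    field
      _∈P      : Carrier → Set
      ∈-resp-≈ : ∀ {a b} → a ≈ b → a ∈P → b ∈P
      ∈-+-cancelˡ : ∀ {a b} → a ∈P → (a + b) ∈P → b ∈P
      ∈-*ʳ     : ∀ {a} b → a ∈P → (a * b) ∈P
      ∈-prime  : ∀ a b → (a * b) ∈P → a ∈P ⊎ b ∈P
      1∉P      : ¬ (1# ∈P)

    ∈-radical : ∀ u n → (u ^ n) ∈P → u ∈P
    ∈-radical u zero    1∈P = ⊥-elim (1∉P 1∈P)
    ∈-radical u (suc n) uuⁿ∈P with ∈-prime u (u ^ n) uuⁿ∈P
    ... | inj₁ u∈P  = u∈P
    ... | inj₂ uⁿ∈P = ∈-radical u n uⁿ∈P

  infix 4 _∈_ _∉_
  _∈_ _∉_ : Carrier → PrimeIdeal → Set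
  a ∈ P = PrimeIdeal._∈P P a
  a ∉ P = ¬ a ∈ P

  -- A consequence of v / π being integral (over A) that makes sense inside A.
  IntegralQuotient : Carrier → Carrier → Set
  IntegralQuotient π v = ∀ {s u} → s * v ≈ π * u → ∃[ n ] ∃[ t ] u ^ n ≈ s * t

  module _ {π v : Carrier} (v/π : IntegralQuotient π v) where

    ∈-quotient : ∀ Q {s u} → s * v ≈ π * u → s ∈ Q → u ∈ Q
    ∈-quotient Q {s} {u} sv≈πu s∈Q with v/π sv≈πu
    ... | n , t , uⁿ≈st = ∈-radical u n (∈-resp-≈ (sym uⁿ≈st) (∈-*ʳ t s∈Q))
      where open PrimeIdeal Q

    numerator∈ : ∀ Q → π ∈ Q → v ∈ Q
    numerator∈ Q = ∈-quotient Q refl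

    -- Because s a = π g, the product s v is π (s t + g y). Hence s t + g y lies in Q, so g y does
    -- too, and g can be removed since Q is prime.
    cofactor∈ : ∀ Q {s a g t y} →
      v ≈ π * t + a * y → s * a ≈ π * g → s ∈ Q → g ∉ Q → y ∈ Q
    cofactor∈ Q {s} {a} {g} {t} {y} v≈ sa≈πg s∈Q g∉Q = conclude (∈-prime g y gy∈Q)
      where
      open PrimeIdeal Q
      open SetoidReasoning setoid
      sv≈ : s * v ≈ π * (s * t + g * y)
      sv≈ = begin
        s * v                             ≈⟨ *-congˡ v≈ ⟩
        s * (π * t + a * y)
          ≈⟨ solve 5 (λ s π t a y → s :* (π :* t :+ a :* y) := π :* (s :* t) :+ s :* a :* y) refl s π t a y ⟩
        π * (s * t) + s * a * y           ≈⟨ +-congˡ (*-congʳ sa≈πg) ⟩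
        π * (s * t) + π * g * y
          ≈⟨ solve 5 (λ s π t g y → π :* (s :* t) :+ π :* g :* y := π :* (s :* t :+ g :* y)) refl s π t g y ⟩
        π * (s * t + g * y)               ∎
      gy∈Q : g * y ∈ Q
      gy∈Q = ∈-+-cancelˡ (∈-*ʳ t s∈Q) (∈-quotient Q sv≈ s∈Q)
      conclude : g ∈ Q ⊎ y ∈ Q → y ∈ Q
      conclude (inj₁ g∈Q) = ⊥-elim (g∉Q g∈Q)
      conclude (inj₂ y∈Q) = y∈Q

    Generated : PrimeIdeal → Carrier → Set
    Generated Q S = ∀ a → a ∈ Q → ∃[ t ] ∃[ y ] a ≈ π * t + S * y

    -- One step of an S-adic expansion of `v` modulo π: a digit lying in Q contributes a further
    -- factor S.
    next-digit : ∀ {Q S} → Generated Q S → ∀ a t y → v ≈ π * t + a * y → y ∈ Q →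
      ∃[ t′ ] ∃[ y′ ] v ≈ π * t′ + a * S * y′
    next-digit {S = S} gen a t y v≈ y∈Q with gen y y∈Q
    ... | t′ , y′ , y≈ = t + a * t′ , y′ , (begin
      v                                   ≈⟨ v≈ ⟩
      π * t + a * y                       ≈⟨ +-congˡ (*-congˡ y≈) ⟩
      π * t + a * (π * t′ + S * y′)
        ≈⟨ solve 6 (λ π t a t′ S y′ → π :* t :+ a :* (π :* t′ :+ S :* y′) := π :* (t :+ a :* t′) :+ a :* S :* y′) refl π t a t′ S y′ ⟩
      π * (t + a * t′) + a * S * y′       ∎)
      where open SetoidReasoning setoid

    -- The hypotheses on g express that A is regular at P and P′; they kill the digits of v one at a time.
    regular⇒divides : ∀ P P′ {S S′ g} →
      S * S * S * S′ ≈ π * g → π ∈ P → S ∈ P → π ∈ P′ → S′ ∈ P′ → Generated P S → Generated P′ S′ →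
      g ∉ P → g ∉ P′ ⊎ S ∉ P′ → ∃[ t ] v ≈ π * t
    regular⇒divides P P′ {S} {S′} {g} S³S′≈πg π∈P S∈P π∈P′ S′∈P′ gen gen′ g∉P outside =
      let t₁ , y₁ , v≈₁ = gen v (numerator∈ P π∈P)
          t₂ , y₂ , v≈₂ = next-digit {P} gen S t₁ y₁ v≈₁ (cofactor∈ P v≈₁ S³S′≈πg′ (P.∈-*ʳ _ S∈P) g∉P)
          t₃ , y₃ , v≈₃ = next-digit {P} gen (S * S) t₂ y₂ v≈₂ (cofactor∈ P v≈₂ S³S′≈πg″ (P.∈-*ʳ _ S∈P) g∉P)
          t₄ , y₄ , v≈₄ = next-digit {P′} gen′ (S * S * S) t₃ y₃ v≈₃ (y₃∈P′ t₃ y₃ v≈₃ outside)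
      in t₄ + g * y₄ , trans v≈₄ (trans (+-congˡ (trans (*-congʳ S³S′≈πg) (*-assoc π g y₄))) (sym (distribˡ π t₄ (g * y₄))))
      where
      module P = PrimeIdeal P
      open PrimeIdeal P′
      S³S′≈πg′ : S * (S * S′) * S ≈ π * g
      S³S′≈πg′ = trans (solve 2 (λ S S′ → S :* (S :* S′) :* S := S :* S :* S :* S′) refl S S′) S³S′≈πg
      S³S′≈πg″ : S * S′ * (S * S) ≈ π * g
      S³S′≈πg″ = trans (solve 2 (λ S S′ → S :* S′ :* (S :* S) := S :* S :* S :* S′) refl S S′) S³S′≈πg
      y₃∈P′ : ∀ t₃ y₃ → v ≈ π * t₃ + S * S * S * y₃ → g ∉ P′ ⊎ S ∉ P′ → y₃ ∈ P′
      y₃∈P′ t₃ y₃ v≈₃ (inj₁ g∉P′) = cofactor∈ P′ v≈₃ (trans (*-comm S′ _) S³S′≈πg) S′∈P′ g∉P′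
      -- Here S is a unit at P′, so v in P′ alone forces the digit into P′, even if g lies in P′.
      y₃∈P′ t₃ y₃ v≈₃ (inj₂ S∉P′)
        with ∈-prime (S * S * S) y₃ (∈-+-cancelˡ (∈-*ʳ t₃ π∈P′) (∈-resp-≈ v≈₃ (numerator∈ P′ π∈P′)))
      ... | inj₂ y₃∈ = y₃∈
      ... | inj₁ S³∈ = ⊥-elim (S∉P′ (∈-radical S 3 (∈-resp-≈ (solve 1 (λ S → S :* S :* S := S :* (S :* (S :* con 1))) refl S) S³∈)))

open ≡ using (refl; sym; trans; cong; cong₂; subst; subst₂; isEquivalence; module ≡-Reasoning)

-- Integers in ℚ

ℤ→ℚ-homo-+ : ∀ a b → ℤ→ℚ (a ℤ.+ b) ≡ ℤ→ℚ a ℚ.+ ℤ→ℚ b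
ℤ→ℚ-homo-+ a b = ℚ.toℚᵘ-injective (begin
  ℚ.toℚᵘ (ℤ→ℚ (a ℤ.+ b))                    ≈⟨ ℚ.toℚᵘ-fromℚᵘ (mkℚᵘ (a ℤ.+ b) 0) ⟩
  mkℚᵘ (a ℤ.+ b) 0                          ≈⟨ *≡* (cong (ℤ._* + 1) (cong₂ ℤ._+_ (ℤ.*-identityʳ a) (ℤ.*-identityʳ b))) ⟨
  mkℚᵘ a 0 ℚᵘ.+ mkℚᵘ b 0                    ≈⟨ ℚᵘ.+-cong (ℚ.toℚᵘ-fromℚᵘ (mkℚᵘ a 0)) (ℚ.toℚᵘ-fromℚᵘ (mkℚᵘ b 0)) ⟨
  ℚ.toℚᵘ (ℤ→ℚ a) ℚᵘ.+ ℚ.toℚᵘ (ℤ→ℚ b)        ≈⟨ ℚ.toℚᵘ-homo-+ (ℤ→ℚ a) (ℤ→ℚ b) ⟨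
  ℚ.toℚᵘ (ℤ→ℚ a ℚ.+ ℤ→ℚ b)                  ∎)
  where open ℚᵘ.≃-Reasoning

ℤ→ℚ-homo-* : ∀ a b → ℤ→ℚ (a ℤ.* b) ≡ ℤ→ℚ a ℚ.* ℤ→ℚ b
ℤ→ℚ-homo-* a b = ℚ.toℚᵘ-injective (begin
  ℚ.toℚᵘ (ℤ→ℚ (a ℤ.* b))                    ≈⟨ ℚ.toℚᵘ-fromℚᵘ (mkℚᵘ (a ℤ.* b) 0) ⟩
  mkℚᵘ a 0 ℚᵘ.* mkℚᵘ b 0                    ≈⟨ ℚᵘ.*-cong (ℚ.toℚᵘ-fromℚᵘ (mkℚᵘ a 0)) (ℚ.toℚᵘ-fromℚᵘ (mkℚᵘ b 0)) ⟨
  ℚ.toℚᵘ (ℤ→ℚ a) ℚᵘ.* ℚ.toℚᵘ (ℤ→ℚ b)        ≈⟨ ℚ.toℚᵘ-homo-* (ℤ→ℚ a) (ℤ→ℚ b) ⟨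
  ℚ.toℚᵘ (ℤ→ℚ a ℚ.* ℤ→ℚ b)                  ∎)
  where open ℚᵘ.≃-Reasoning

ℤ→ℚ-homo-neg : ∀ a → ℤ→ℚ (ℤ.- a) ≡ ℚ.- ℤ→ℚ a
ℤ→ℚ-homo-neg a = ℚ.toℚᵘ-injective (begin
  ℚ.toℚᵘ (ℤ→ℚ (ℤ.- a))   ≈⟨ ℚ.toℚᵘ-fromℚᵘ (mkℚᵘ (ℤ.- a) 0) ⟩
  ℚᵘ.- mkℚᵘ a 0          ≈⟨ ℚᵘ.-‿cong (ℚ.toℚᵘ-fromℚᵘ (mkℚᵘ a 0)) ⟨
  ℚᵘ.- ℚ.toℚᵘ (ℤ→ℚ a)    ≈⟨ ℚ.toℚᵘ-homo‿- (ℤ→ℚ a) ⟨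
  ℚ.toℚᵘ (ℚ.- ℤ→ℚ a)     ∎)
  where open ℚᵘ.≃-Reasoning

ℤ→ℚ-injective : ∀ {a b} → ℤ→ℚ a ≡ ℤ→ℚ b → a ≡ b
ℤ→ℚ-injective {a} {b} eq with ℚ.fromℚᵘ-injective {mkℚᵘ a 0} {mkℚᵘ b 0} eq
... | *≡* a1≡b1 = trans (sym (ℤ.*-identityʳ a)) (trans a1≡b1 (ℤ.*-identityʳ b))

ℤ→ℚ-mono : IsRingMonomorphism ℤ.+-*-rawRing ℚ.+-*-rawRing ℤ→ℚ
ℤ→ℚ-mono = record
  { isRingHomomorphism = record
    { isSemiringHomomorphism = record
      { isNearSemiringHomomorphism = record
        { +-isMonoidHomomorphism = record
          { isMagmaHomomorphism = record
            { isRelHomomorphism = record { cong = cong ℤ→ℚ }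
            ; homo = ℤ→ℚ-homo-+ }
          ; ε-homo = refl }
        ; *-homo = ℤ→ℚ-homo-* }
      ; 1#-homo = refl }
    ; -‿homo = ℤ→ℚ-homo-neg }
  ; injective = ℤ→ℚ-injective }

ℤ→ℚ-morphism : ℤ.+-*-rawRing -Raw-AlmostCommutative⟶ fromCommutativeRing ℚ.+-*-commutativeRing
ℤ→ℚ-morphism = record
  { ⟦_⟧ = ℤ→ℚ ; +-homo = ℤ→ℚ-homo-+ ; *-homo = ℤ→ℚ-homo-* ; -‿homo = ℤ→ℚ-homo-neg ; 0-homo = refl ; 1-homo = refl }

ℤ→ℚ-≟ : ∀ a b → Maybe (ℤ→ℚ a ≡ ℤ→ℚ b)
ℤ→ℚ-≟ a b = Maybe.map (cong ℤ→ℚ) (dec⇒weaklyDec ℤ._≟_ a b)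

-- Integer coefficients: normalising rational ones is slow.
module ℚ-Solver = RingSolver ℤ.+-*-rawRing (fromCommutativeRing ℚ.+-*-commutativeRing) ℤ→ℚ-morphism ℤ→ℚ-≟

↧*≡↥ : ∀ q → ℤ→ℚ (ℚ.↧ q) ℚ.* q ≡ ℤ→ℚ (ℚ.↥ q)
↧*≡↥ q@record{} = ℚ.toℚᵘ-injective (begin
  ℚ.toℚᵘ (ℤ→ℚ (ℚ.↧ q) ℚ.* q)               ≈⟨ ℚ.toℚᵘ-homo-* (ℤ→ℚ (ℚ.↧ q)) q ⟩
  ℚ.toℚᵘ (ℤ→ℚ (ℚ.↧ q)) ℚᵘ.* ℚ.toℚᵘ q       ≈⟨ ℚᵘ.*-cong (ℚ.toℚᵘ-fromℚᵘ (mkℚᵘ (ℚ.↧ q) 0)) ℚᵘ.≃-refl ⟩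
  mkℚᵘ (ℚ.↧ q) 0 ℚᵘ.* ℚ.toℚᵘ q             ≈⟨ *≡* lemma ⟩
  mkℚᵘ (ℚ.↥ q) 0                           ≈⟨ ℚ.toℚᵘ-fromℚᵘ (mkℚᵘ (ℚ.↥ q) 0) ⟨
  ℚ.toℚᵘ (ℤ→ℚ (ℚ.↥ q))                     ∎)
  where
  open ℚᵘ.≃-Reasoning
  lemma : ℚ.↧ q ℤ.* ℚ.↥ q ℤ.* + 1 ≡ ℚ.↥ q ℤ.* ℚᵘ.↧ (mkℚᵘ (ℚ.↧ q) 0 ℚᵘ.* ℚ.toℚᵘ q)
  lemma = trans (ℤ.*-identityʳ _) (trans (ℤ.*-comm (ℚ.↧ q) (ℚ.↥ q)) (cong (λ d → ℚ.↥ q ℤ.* + d) (sym (ℕ.+-identityʳ _))))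
    where import Data.Nat.Properties as ℕ

ℚ-inverse : ∀ q → q ≢ 0ℚ → ∃[ r ] r ℚ.* q ≡ 1ℚ
ℚ-inverse q q≢0 = (ℚ.1/ q) {{ℚ.≢-nonZero q≢0}} , ℚ.*-inverseˡ q {{ℚ.≢-nonZero q≢0}}

infix 4 _Clears_
record _Clears_ (D : ℕ) (q : ℚ) : Set where
  constructor _,_
  field
    numerator : ℤ
    cleared   : ℤ→ℚ (+ D) ℚ.* q ≡ ℤ→ℚ numerator
open _Clears_

clears-*ˡ : ∀ k {D q} → D Clears q → (k ℕ.* D) Clears q
clears-*ˡ k {D} {q} (z , eq) = + k ℤ.* z , (begin
  ℤ→ℚ (+ (k ℕ.* D)) ℚ.* q                 ≡⟨ cong (λ x → ℤ→ℚ x ℚ.* q) (ℤ.pos-* k D) ⟩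
  ℤ→ℚ (+ k ℤ.* + D) ℚ.* q                 ≡⟨ cong (ℚ._* q) (ℤ→ℚ-homo-* (+ k) (+ D)) ⟩
  ℤ→ℚ (+ k) ℚ.* ℤ→ℚ (+ D) ℚ.* q           ≡⟨ ℚ.*-assoc (ℤ→ℚ (+ k)) (ℤ→ℚ (+ D)) q ⟩
  ℤ→ℚ (+ k) ℚ.* (ℤ→ℚ (+ D) ℚ.* q)         ≡⟨ cong (ℤ→ℚ (+ k) ℚ.*_) eq ⟩
  ℤ→ℚ (+ k) ℚ.* ℤ→ℚ z                     ≡⟨ ℤ→ℚ-homo-* (+ k) z ⟨
  ℤ→ℚ (+ k ℤ.* z)                         ∎)
  where open ≡-Reasoning

clears-*ʳ : ∀ k {D q} → D Clears q → (D ℕ.* k) Clears q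
clears-*ʳ k {D} {q} D-clears = subst (_Clears q) (ℕ.*-comm k D) (clears-*ˡ k D-clears)

↧ₙ-clears : ∀ q → ℚ.↧ₙ q Clears q
↧ₙ-clears q = ℚ.↥ q , ↧*≡↥ q

coprime-^∣⇒≡1 : ∀ {u d : ℕ} → Coprimality.Coprime d u → ∀ n → d ℕ.∣ u ℕ.^ n → d ≡ 1
coprime-^∣⇒≡1 coprime zero    d∣ = ℕ.∣1⇒≡1 d∣
coprime-^∣⇒≡1 coprime (suc n) d∣ = coprime-^∣⇒≡1 coprime n (Coprimality.coprime-divisor coprime d∣)

↧≡1⇒integer : ∀ q → ℚ.↧ₙ q ≡ 1 → ∃[ z ] q ≡ ℤ→ℚ z
↧≡1⇒integer q ↧≡1 = ℚ.↥ q , trans (sym (ℚ.*-identityˡ q)) (trans (cong (λ d → ℤ→ℚ (+ d) ℚ.* q) (sym ↧≡1)) (↧*≡↥ q))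

-- The rational root theorem for monic polynomials: the denominator divides a power of the
-- numerator, to which it is coprime.
integral⇒integer : ∀ q cs → evalAt ℚ.+-*-commutativeRing ℤ→ℚ (cs ++ [ + 1 ]) q ≡ 0ℚ → ∃[ z ] q ≡ ℤ→ℚ z
integral⇒integer q cs root with Integrality.integral⇒∣power ℤ.+-*-commutativeRing ℚ.+-*-commutativeRing ℤ→ℚ-mono {j = id} refl
  {ℚ.↧ q} {ℚ.↥ q} {q} {cs} (↧*≡↥ q) root
... | n , t , ↥ⁿ≡↧t = ↧≡1⇒integer q (coprime-^∣⇒≡1 (coprime q) n
      (subst (ℚ.↧ₙ q ℕ.∣_) (abs-^ (ℚ.↥ q) n) (Signed.∣⇒∣ᵤ (divides t (trans ↥ⁿ≡↧t (ℤ.*-comm (ℚ.↧ q) t))))))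
  where
  open Exponentiation (CommutativeRing.semiring ℤ.+-*-commutativeRing) using (_^_)
  coprime : ∀ q → Coprimality.Coprime (ℚ.↧ₙ q) ℤ.∣ ℚ.↥ q ∣
  coprime (ℚ.mkℚ _ _ c) = Coprimality.sym (Coprimality.recompute c)
  abs-^ : ∀ u n → ℤ.∣ u ^ n ∣ ≡ ℤ.∣ u ∣ ℕ.^ n
  abs-^ u zero    = refl
  abs-^ u (suc n) = trans (ℤ.abs-* u (u ^ n)) (cong (ℤ.∣ u ∣ ℕ.*_) (abs-^ u n))

integer-root : ∀ cs z → evalAt ℚ.+-*-commutativeRing ℤ→ℚ cs (ℤ→ℚ z) ≡ 0ℚ → evalAt ℤ.+-*-commutativeRing id cs z ≡ + 0
integer-root cs z root = ℤ→ℚ-injective (trans (sym (evalAt-homo ℤ.+-*-commutativeRing ℚ.+-*-commutativeRing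
  (IsRingMonomorphism.isRingHomomorphism ℤ→ℚ-mono) id cs z)) root)

-- Polynomials over ℚ

coeff-+ₚ : ∀ p q k → coeff (p +ₚ q) k ≡ coeff p k ℚ.+ coeff q k
coeff-+ₚ []      q       k       = sym (ℚ.+-identityˡ _)
coeff-+ₚ (a ∷ p) []      k       = sym (ℚ.+-identityʳ _)
coeff-+ₚ (a ∷ p) (b ∷ q) zero    = refl
coeff-+ₚ (a ∷ p) (b ∷ q) (suc k) = coeff-+ₚ p q k

coeff-scale : ∀ a p k → coeff (scale a p) k ≡ a ℚ.* coeff p k
coeff-scale a []      k       = sym (ℚ.*-zeroʳ a)
coeff-scale a (b ∷ p) zero    = refl
coeff-scale a (b ∷ p) (suc k) = coeff-scale a p k

coeff-*ₚ-∷-zero : ∀ p b q → coeff (p *ₚ (b ∷ q)) 0 ≡ coeff p 0 ℚ.* b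
coeff-*ₚ-∷-zero []      b q = sym (ℚ.*-zeroˡ b)
coeff-*ₚ-∷-zero (a ∷ p) b q = ℚ.+-identityʳ _

coeff-∷-*ₚ-suc : ∀ a p q k → coeff ((a ∷ p) *ₚ q) (suc k) ≡ a ℚ.* coeff q (suc k) ℚ.+ coeff (p *ₚ q) k
coeff-∷-*ₚ-suc a p q k = trans (coeff-+ₚ (scale a q) _ (suc k)) (cong (ℚ._+ _) (coeff-scale a q (suc k)))

-- Multiplication recurses on its first factor, whereas `divide-by-f` prepends coefficients to the
-- second; this is the recursion on that side.
coeff-*ₚ-∷-suc : ∀ p b q k → coeff (p *ₚ (b ∷ q)) (suc k) ≡ coeff p (suc k) ℚ.* b ℚ.+ coeff (p *ₚ q) k
coeff-*ₚ-∷-suc []      b q k = sym (trans (ℚ.+-identityʳ _) (ℚ.*-zeroˡ b))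
coeff-*ₚ-∷-suc (a ∷ p) b q zero = begin
  coeff ((a ∷ p) *ₚ (b ∷ q)) 1                    ≡⟨ coeff-∷-*ₚ-suc a p (b ∷ q) 0 ⟩
  a ℚ.* coeff q 0 ℚ.+ coeff (p *ₚ (b ∷ q)) 0      ≡⟨ cong (a ℚ.* coeff q 0 ℚ.+_) (coeff-*ₚ-∷-zero p b q) ⟩
  a ℚ.* coeff q 0 ℚ.+ coeff p 0 ℚ.* b             ≡⟨ ℚ.+-comm (a ℚ.* coeff q 0) _ ⟩
  coeff p 0 ℚ.* b ℚ.+ a ℚ.* coeff q 0             ≡⟨ cong (coeff p 0 ℚ.* b ℚ.+_) (ℚ.+-identityʳ _) ⟨
  coeff p 0 ℚ.* b ℚ.+ (a ℚ.* coeff q 0 ℚ.+ 0ℚ)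
    ≡⟨ cong (λ x → coeff p 0 ℚ.* b ℚ.+ (x ℚ.+ 0ℚ)) (coeff-scale a q 0) ⟨
  coeff p 0 ℚ.* b ℚ.+ (coeff (scale a q) 0 ℚ.+ 0ℚ)
    ≡⟨ cong (coeff p 0 ℚ.* b ℚ.+_) (coeff-+ₚ (scale a q) (0ℚ ∷ p *ₚ q) 0) ⟨
  coeff p 0 ℚ.* b ℚ.+ coeff ((a ∷ p) *ₚ q) 0      ∎
  where open ≡-Reasoning
coeff-*ₚ-∷-suc (a ∷ p) b q (suc k) = begin
  coeff ((a ∷ p) *ₚ (b ∷ q)) (suc (suc k))
    ≡⟨ coeff-∷-*ₚ-suc a p (b ∷ q) (suc k) ⟩
  a ℚ.* coeff q (suc k) ℚ.+ coeff (p *ₚ (b ∷ q)) (suc k)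
    ≡⟨ cong (a ℚ.* coeff q (suc k) ℚ.+_) (coeff-*ₚ-∷-suc p b q k) ⟩
  a ℚ.* coeff q (suc k) ℚ.+ (coeff p (suc k) ℚ.* b ℚ.+ coeff (p *ₚ q) k)
    ≡⟨ solve 3 (λ x y z → x :+ (y :+ z) := y :+ (x :+ z)) refl (a ℚ.* coeff q (suc k)) (coeff p (suc k) ℚ.* b) (coeff (p *ₚ q) k) ⟩
  coeff p (suc k) ℚ.* b ℚ.+ (a ℚ.* coeff q (suc k) ℚ.+ coeff (p *ₚ q) k)
    ≡⟨ cong (coeff p (suc k) ℚ.* b ℚ.+_) (coeff-∷-*ₚ-suc a p q k) ⟨
  coeff p (suc k) ℚ.* b ℚ.+ coeff ((a ∷ p) *ₚ q) (suc k) ∎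
  where
  open ≡-Reasoning
  open ℚ-Solver

-- On coefficient functions rather than lists, so that degree bounds can be used whatever trailing
-- zeros the lists carry.
convolve : (ℕ → ℚ) → (ℕ → ℚ) → ℕ → ℚ
convolve P Q zero    = P 0 ℚ.* Q 0
convolve P Q (suc k) = P 0 ℚ.* Q (suc k) ℚ.+ convolve (P ∘ suc) Q k

convolve-zero : ∀ P Q → (∀ i → P i ≡ 0ℚ) → ∀ k → convolve P Q k ≡ 0ℚ
convolve-zero P Q P≡0 zero    = trans (cong (ℚ._* Q 0) (P≡0 0)) (ℚ.*-zeroˡ (Q 0))
convolve-zero P Q P≡0 (suc k) = cong₂ ℚ._+_ (trans (cong (ℚ._* Q (suc k)) (P≡0 0)) (ℚ.*-zeroˡ (Q (suc k))))
  (convolve-zero (P ∘ suc) Q (P≡0 ∘ suc) k)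

coeff-*ₚ : ∀ p q k → coeff (p *ₚ q) k ≡ convolve (coeff p) (coeff q) k
coeff-*ₚ []      q k       = sym (convolve-zero (coeff []) (coeff q) (λ _ → refl) k)
coeff-*ₚ (a ∷ p) q zero    = trans (coeff-+ₚ (scale a q) _ 0) (trans (ℚ.+-identityʳ _) (coeff-scale a q 0))
coeff-*ₚ (a ∷ p) q (suc k) = trans (coeff-∷-*ₚ-suc a p q k) (cong (a ℚ.* coeff q (suc k) ℚ.+_) (coeff-*ₚ p q k))

VanishesAbove : ℕ → (ℕ → ℚ) → Set
VanishesAbove d P = ∀ k → d ℕ.< k → P k ≡ 0ℚ

-- Among the summands P i · Q (d + e - i), those with i < d have an index above e in Q, and those
-- with i > d an index above d in P.
convolve-top : ∀ d e P Q → VanishesAbove d P → VanishesAbove e Q → convolve P Q (d ℕ.+ e) ≡ P d ℚ.* Q e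
convolve-top zero    zero    P Q P-deg Q-deg = refl
convolve-top zero    (suc e) P Q P-deg Q-deg = trans
  (cong (P 0 ℚ.* Q (suc e) ℚ.+_) (convolve-zero (P ∘ suc) Q (λ i → P-deg (suc i) (ℕ.s≤s ℕ.z≤n)) e)) (ℚ.+-identityʳ _)
convolve-top (suc d) e       P Q P-deg Q-deg = trans
  (cong₂ ℚ._+_ (trans (cong (P 0 ℚ.*_) (Q-deg (suc (d ℕ.+ e)) (ℕ.s≤s (ℕ.m≤n+m e d)))) (ℚ.*-zeroʳ (P 0)))
               (convolve-top d e (P ∘ suc) Q (λ k d<k → P-deg (suc k) (ℕ.s≤s d<k)) Q-deg))
  (ℚ.+-identityˡ _)

data Degree (p : Poly) : Set where
  zero-poly : (∀ k → coeff p k ≡ 0ℚ) → Degree p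
  degree    : ∀ d → coeff p d ≢ 0ℚ → VanishesAbove d (coeff p) → Degree p

findDegree : ∀ p → Degree p
findDegree [] = zero-poly λ _ → refl
findDegree (a ∷ p) with findDegree p
... | degree d p_d≢0 vanishes = degree (suc d) p_d≢0 λ where (suc k) (ℕ.s≤s d<k) → vanishes k d<k
... | zero-poly p≡0 with a ℚ.≟ 0ℚ
...   | yes a≡0 = zero-poly λ where
        zero    → a≡0
        (suc k) → p≡0 k
...   | no  a≢0 = degree 0 a≢0 λ where (suc k) _ → p≡0 k

*-≢0 : ∀ {a b} → a ≢ 0ℚ → b ≢ 0ℚ → a ℚ.* b ≢ 0ℚ
*-≢0 {a} {b} a≢0 b≢0 ab≡0 with ℚ-inverse a a≢0
... | r , ra≡1 = b≢0 (begin
  b                  ≡⟨ ℚ.*-identityˡ b ⟨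
  1ℚ ℚ.* b           ≡⟨ cong (ℚ._* b) ra≡1 ⟨
  r ℚ.* a ℚ.* b      ≡⟨ ℚ.*-assoc r a b ⟩
  r ℚ.* (a ℚ.* b)    ≡⟨ cong (r ℚ.*_) ab≡0 ⟩
  r ℚ.* 0ℚ           ≡⟨ ℚ.*-zeroʳ r ⟩
  0ℚ                 ∎)
  where open ≡-Reasoning

-- Serves twice: at θ in K, where it is reduction modulo f, and at a rational number, where it
-- detects linear factors.
module Evaluation (R : CommutativeRing 0ℓ 0ℓ) {h : ℚ → CommutativeRing.Carrier R}
  (h-homo : IsRingHomomorphism ℚ.+-*-rawRing (CommutativeRing.rawRing R) h) (t : CommutativeRing.Carrier R) where

  open CommutativeRing R hiding (refl; sym; trans)
  open IsRingHomomorphism h-homo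
  open NaturalSolver commutativeSemiring
  private
    module R = CommutativeRing R
    module ≈-Reasoning = SetoidReasoning setoid

  evalₚ : Poly → Carrier
  evalₚ []      = 0#
  evalₚ (a ∷ p) = h a + t * evalₚ p

  evalₚ-+ₚ : ∀ p q → evalₚ (p +ₚ q) ≈ evalₚ p + evalₚ q
  evalₚ-+ₚ []      q       = R.sym (+-identityˡ _)
  evalₚ-+ₚ (a ∷ p) []      = R.sym (+-identityʳ _)
  evalₚ-+ₚ (a ∷ p) (b ∷ q) = begin
    h (a ℚ.+ b) + t * evalₚ (p +ₚ q)              ≈⟨ +-cong (+-homo a b) (*-congˡ (evalₚ-+ₚ p q)) ⟩
    (h a + h b) + t * (evalₚ p + evalₚ q)
      ≈⟨ solve 5 (λ a b t p q → (a :+ b) :+ t :* (p :+ q) := (a :+ t :* p) :+ (b :+ t :* q)) R.refl (h a) (h b) t (evalₚ p) (evalₚ q) ⟩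
    evalₚ (a ∷ p) + evalₚ (b ∷ q)                 ∎
    where open ≈-Reasoning

  evalₚ-scale : ∀ a p → evalₚ (scale a p) ≈ h a * evalₚ p
  evalₚ-scale a []      = R.sym (zeroʳ _)
  evalₚ-scale a (b ∷ p) = begin
    h (a ℚ.* b) + t * evalₚ (scale a p)           ≈⟨ +-cong (*-homo a b) (*-congˡ (evalₚ-scale a p)) ⟩
    h a * h b + t * (h a * evalₚ p)
      ≈⟨ solve 4 (λ a b t p → a :* b :+ t :* (a :* p) := a :* (b :+ t :* p)) R.refl (h a) (h b) t (evalₚ p) ⟩
    h a * evalₚ (b ∷ p)                           ∎
    where open ≈-Reasoning

  evalₚ-0∷ : ∀ p → evalₚ (0ℚ ∷ p) ≈ t * evalₚ p
  evalₚ-0∷ p = R.trans (+-congʳ 0#-homo) (+-identityˡ _)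

  evalₚ-*ₚ : ∀ p q → evalₚ (p *ₚ q) ≈ evalₚ p * evalₚ q
  evalₚ-*ₚ []      q = R.sym (zeroˡ _)
  evalₚ-*ₚ (a ∷ p) q = begin
    evalₚ (scale a q +ₚ (0ℚ ∷ p *ₚ q))            ≈⟨ evalₚ-+ₚ (scale a q) _ ⟩
    evalₚ (scale a q) + evalₚ (0ℚ ∷ p *ₚ q)
      ≈⟨ +-cong (evalₚ-scale a q) (R.trans (evalₚ-0∷ (p *ₚ q)) (*-congˡ (evalₚ-*ₚ p q))) ⟩
    h a * evalₚ q + t * (evalₚ p * evalₚ q)
      ≈⟨ solve 4 (λ a q t p → a :* q :+ t :* (p :* q) := (a :+ t :* p) :* q) R.refl (h a) (evalₚ q) t (evalₚ p) ⟩
    evalₚ (a ∷ p) * evalₚ q                       ∎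
    where open ≈-Reasoning

  evalₚ-zero : ∀ p → (∀ k → coeff p k ≡ 0ℚ) → evalₚ p ≈ 0#
  evalₚ-zero []      p≈0 = R.refl
  evalₚ-zero (a ∷ p) p≈0 = R.trans (+-cong (⟦⟧-cong (p≈0 0)) (*-congˡ (evalₚ-zero p (λ k → p≈0 (suc k)))))
    (R.trans (evalₚ-0∷ []) (zeroʳ t))

  evalₚ-cong : ∀ p q → p ≈ₚ q → evalₚ p ≈ evalₚ q
  evalₚ-cong []      q       p≈q = R.sym (evalₚ-zero q (λ k → sym (p≈q k)))
  evalₚ-cong (a ∷ p) []      p≈q = evalₚ-zero (a ∷ p) p≈q
  evalₚ-cong (a ∷ p) (b ∷ q) p≈q = +-cong (⟦⟧-cong (p≈q 0)) (*-congˡ (evalₚ-cong p q (λ k → p≈q (suc k))))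

  evalₚ-negₚ : ∀ p → evalₚ (negₚ p) ≈ - evalₚ p
  evalₚ-negₚ p = RingProperties.+-inverseˡ-unique ring _ _ (R.trans (R.sym (evalₚ-+ₚ (negₚ p) p)) (evalₚ-zero (negₚ p +ₚ p) cancel))
    where
    coeff-negₚ : ∀ p k → coeff (negₚ p) k ≡ ℚ.- coeff p k
    coeff-negₚ []      k       = refl
    coeff-negₚ (a ∷ p) zero    = refl
    coeff-negₚ (a ∷ p) (suc k) = coeff-negₚ p k
    cancel : ∀ k → coeff (negₚ p +ₚ p) k ≡ 0ℚ
    cancel k = trans (coeff-+ₚ (negₚ p) p k) (trans (cong (ℚ._+ coeff p k) (coeff-negₚ p k)) (ℚ.+-inverseˡ (coeff p k)))

-- ℤ[θ] and ℚ(θ)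

record Quad (X : Set) : Set where
  constructor quad
  field
    x₀ x₁ x₂ x₃ : X
open Quad

≡quad : {X : Set} {v w : Quad X} → x₀ v ≡ x₀ w → x₁ v ≡ x₁ w → x₂ v ≡ x₂ w → x₃ v ≡ x₃ w → v ≡ w
≡quad refl refl refl refl = refl

-- No ring laws are assumed, so that X may also be the syntax of a ring solver. Identities between
-- products can then be stated to the solver as such, one coordinate at a time.
module QuadOps {X : Set} (_+_ _*_ : X → X → X) (c₀ c₁ c₂ : X) where
  infixl 6 _⊕_
  infixl 7 _⊛_
  infixr 7 _·_

  -- Opaque, as unification would otherwise unfold the operations of ℤ and ℚ.
  opaque
    _⊕_ : Quad X → Quad X → Quad X
    v ⊕ w = quad (x₀ v + x₀ w) (x₁ v + x₁ w) (x₂ v + x₂ w) (x₃ v + x₃ w)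

    _·_ : X → Quad X → Quad X
    k · v = quad (k * x₀ v) (k * x₁ v) (k * x₂ v) (k * x₃ v)

    θ· : Quad X → Quad X
    θ· v = quad (c₀ * x₃ v) (x₀ v + (c₁ * x₃ v)) (x₁ v + (c₂ * x₃ v)) (x₂ v)

    _⊛_ : Quad X → Quad X → Quad X
    v ⊛ w = x₀ v · w ⊕ (x₁ v · θ· w ⊕ (x₂ v · θ· (θ· w) ⊕ x₃ v · θ· (θ· (θ· w))))

≡-commutativeRing : {X : Set} {_+_ _*_ : X → X → X} { -_ : X → X} {0# 1# : X} →
  IsCommutativeRing _≡_ _+_ _*_ -_ 0# 1# → CommutativeRing 0ℓ 0ℓ
≡-commutativeRing isRing = record { isCommutativeRing = isRing }

-- R[θ] with θ⁴ = c₀ + c₁ θ + c₂ θ², in the basis 1, θ, θ², θ³.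
module Quartic {X : Set} {_+_ _*_ : X → X → X} { -_ : X → X} {0# 1# : X}
  (isRing : IsCommutativeRing _≡_ _+_ _*_ -_ 0# 1#) (c₀ c₁ c₂ : X) where

  private
    module R = CommutativeRing (≡-commutativeRing isRing)

  open NaturalSolver R.commutativeSemiring

  open QuadOps _+_ _*_ c₀ c₁ c₂ public
  private module P {n} = QuadOps {Polynomial n} _:+_ _:*_

  const : X → Quad X
  const k = quad k 0# 0# 0#

  𝟘 𝟙 θ : Quad X
  𝟘 = const 0#
  𝟙 = const 1#
  θ = quad 0# 1# 0# 0#

  opaque
    unfolding QuadOps._⊛_

    ⊝_ : Quad X → Quad X
    ⊝ v = quad (- x₀ v) (- x₁ v) (- x₂ v) (- x₃ v)

    ⊕-assoc : ∀ u v w → (u ⊕ v) ⊕ w ≡ u ⊕ (v ⊕ w)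
    ⊕-assoc u v w = ≡quad (R.+-assoc _ _ _) (R.+-assoc _ _ _) (R.+-assoc _ _ _) (R.+-assoc _ _ _)

    ⊕-comm : ∀ v w → v ⊕ w ≡ w ⊕ v
    ⊕-comm v w = ≡quad (R.+-comm _ _) (R.+-comm _ _) (R.+-comm _ _) (R.+-comm _ _)

    ⊕-identityˡ : ∀ v → 𝟘 ⊕ v ≡ v
    ⊕-identityˡ v = ≡quad (R.+-identityˡ _) (R.+-identityˡ _) (R.+-identityˡ _) (R.+-identityˡ _)

    ⊝-inverseˡ : ∀ v → ⊝ v ⊕ v ≡ 𝟘
    ⊝-inverseˡ v = ≡quad (R.-‿inverseˡ _) (R.-‿inverseˡ _) (R.-‿inverseˡ _) (R.-‿inverseˡ _)

    ⊛-comm : ∀ v w → v ⊛ w ≡ w ⊛ v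
    ⊛-comm (quad a b c d) (quad a' b' c' d') =
      let eq = λ (x : Quad (Polynomial 11) → Polynomial 11) a b c d a' b' c' d' c₀ c₁ c₂ →
            let v = quad a b c d
                w = quad a' b' c' d'
                open P c₀ c₁ c₂ renaming (_⊛_ to _:⊛_)
            in x (v :⊛ w) := x (w :⊛ v)
      in ≡quad (solve 11 (eq x₀) refl a b c d a' b' c' d' c₀ c₁ c₂)
               (solve 11 (eq x₁) refl a b c d a' b' c' d' c₀ c₁ c₂)
               (solve 11 (eq x₂) refl a b c d a' b' c' d' c₀ c₁ c₂)
               (solve 11 (eq x₃) refl a b c d a' b' c' d' c₀ c₁ c₂)

    ⊛-distribʳ : ∀ u v w → (v ⊕ w) ⊛ u ≡ v ⊛ u ⊕ w ⊛ u
    ⊛-distribʳ u v w =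
      let lemma = solve 12 (λ a b c d a' b' c' d' e f g h →
            (a :+ a') :* e :+ ((b :+ b') :* f :+ ((c :+ c') :* g :+ (d :+ d') :* h)) :=
            (a :* e :+ (b :* f :+ (c :* g :+ d :* h))) :+ (a' :* e :+ (b' :* f :+ (c' :* g :+ d' :* h)))) refl
      in ≡quad (lemma _ _ _ _ _ _ _ _ _ _ _ _) (lemma _ _ _ _ _ _ _ _ _ _ _ _)
               (lemma _ _ _ _ _ _ _ _ _ _ _ _) (lemma _ _ _ _ _ _ _ _ _ _ _ _)

    const-⊛ : ∀ k v → const k ⊛ v ≡ k · v
    const-⊛ k v =
      let lemma = solve 5 (λ a b c d e →
            a :* b :+ (con 0 :* c :+ (con 0 :* d :+ con 0 :* e)) := a :* b) refl
      in ≡quad (lemma _ _ _ _ _) (lemma _ _ _ _ _) (lemma _ _ _ _ _) (lemma _ _ _ _ _)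

    θ-⊛ : ∀ v → θ ⊛ v ≡ θ· v
    θ-⊛ v =
      let lemma = solve 4 (λ a b c d →
            con 0 :* a :+ (con 1 :* b :+ (con 0 :* c :+ con 0 :* d)) := b) refl
      in ≡quad (lemma _ _ _ _) (lemma _ _ _ _) (lemma _ _ _ _) (lemma _ _ _ _)

    ⊛-identityˡ : ∀ v → 𝟙 ⊛ v ≡ v
    ⊛-identityˡ v = trans (const-⊛ 1# v)
      (≡quad (R.*-identityˡ _) (R.*-identityˡ _) (R.*-identityˡ _) (R.*-identityˡ _))

    ⊛-assoc : ∀ u v w → (u ⊛ v) ⊛ w ≡ u ⊛ (v ⊛ w)
    ⊛-assoc (quad a b c d) (quad a' b' c' d') (quad a″ b″ c″ d″) =
      let eq = λ (x : Quad (Polynomial 15) → Polynomial 15) a b c d a' b' c' d' a″ b″ c″ d″ c₀ c₁ c₂ →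
            let u = quad a b c d
                v = quad a' b' c' d'
                w = quad a″ b″ c″ d″
                open P c₀ c₁ c₂ renaming (_⊛_ to _:⊛_)
            in x ((u :⊛ v) :⊛ w) := x (u :⊛ (v :⊛ w))
      in ≡quad (solve 15 (eq x₀) refl a b c d a' b' c' d' a″ b″ c″ d″ c₀ c₁ c₂)
               (solve 15 (eq x₁) refl a b c d a' b' c' d' a″ b″ c″ d″ c₀ c₁ c₂)
               (solve 15 (eq x₂) refl a b c d a' b' c' d' a″ b″ c″ d″ c₀ c₁ c₂)
               (solve 15 (eq x₃) refl a b c d a' b' c' d' a″ b″ c″ d″ c₀ c₁ c₂)

  commutativeRing : CommutativeRing 0ℓ 0ℓ
  commutativeRing = record
    { isCommutativeRing = record
      { isRing = record
        { +-isAbelianGroup = record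
          { isGroup = record
            { isMonoid = record
              { isSemigroup = record
                { isMagma = record { isEquivalence = isEquivalence ; ∙-cong = cong₂ _⊕_ }
                ; assoc = ⊕-assoc }
              ; identity = comm∧idˡ⇒id ⊕-comm ⊕-identityˡ }
            ; inverse = comm∧invˡ⇒inv ⊕-comm ⊝-inverseˡ
            ; ⁻¹-cong = cong ⊝_ }
          ; comm = ⊕-comm }
        ; *-cong = cong₂ _⊛_
        ; *-assoc = ⊛-assoc
        ; *-identity = comm∧idˡ⇒id ⊛-comm ⊛-identityˡ
        ; distrib = comm∧distrʳ⇒distrˡ ⊛-comm ⊛-distribʳ , ⊛-distribʳ }
      ; *-comm = ⊛-comm } }

  opaque
    unfolding QuadOps._⊛_ ⊝_

    const-homo : IsRingHomomorphism R.rawRing (CommutativeRing.rawRing commutativeRing) const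
    const-homo = record
      { isSemiringHomomorphism = record
        { isNearSemiringHomomorphism = record
          { +-isMonoidHomomorphism = record
            { isMagmaHomomorphism = record
              { isRelHomomorphism = record { cong = cong const }
              ; homo = λ a b → ≡quad refl 0≡0+0 0≡0+0 0≡0+0 }
            ; ε-homo = refl }
          ; *-homo = λ a b → sym (trans (const-⊛ a (const b)) (≡quad refl (R.zeroʳ a) (R.zeroʳ a) (R.zeroʳ a))) }
        ; 1#-homo = refl }
      ; -‿homo = λ a → ≡quad refl 0≡-0 0≡-0 0≡-0 }
      where
      0≡0+0 : 0# ≡ 0# + 0#
      0≡0+0 = sym (R.+-identityʳ 0#)
      0≡-0 : 0# ≡ - 0#
      0≡-0 = sym (RingProperties.-0#≈0# R.ring)

module BaseChange
  {X : Set} {_+_ _*_ : X → X → X} { -_ : X → X} {0# 1# : X} (isRing : IsCommutativeRing _≡_ _+_ _*_ -_ 0# 1#)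
  {Y : Set} {_+′_ _*′_ : Y → Y → Y} { -′_ : Y → Y} {0#′ 1#′ : Y} (isRing′ : IsCommutativeRing _≡_ _+′_ _*′_ -′_ 0#′ 1#′)
  (h : X → Y)
  (mono : IsRingMonomorphism (CommutativeRing.rawRing (≡-commutativeRing isRing))
                             (CommutativeRing.rawRing (≡-commutativeRing isRing′)) h)
  (c₀ c₁ c₂ : X) where

  private
    module A = Quartic isRing c₀ c₁ c₂
    module K = Quartic isRing′ (h c₀) (h c₁) (h c₂)
  open IsRingMonomorphism mono

  opaque
    ι : Quad X → Quad Y
    ι v = quad (h (x₀ v)) (h (x₁ v)) (h (x₂ v)) (h (x₃ v))

  opaque
    unfolding ι QuadOps._⊛_ A.⊝_

    ι-quad : ∀ v → ι v ≡ quad (h (x₀ v)) (h (x₁ v)) (h (x₂ v)) (h (x₃ v))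
    ι-quad v = refl

    ι-const : ∀ k → ι (A.const k) ≡ K.const (h k)
    ι-const k = ≡quad refl 0#-homo 0#-homo 0#-homo

    ι-θ : ι A.θ ≡ K.θ
    ι-θ = ≡quad 0#-homo 1#-homo 0#-homo 0#-homo

    ι-⊕ : ∀ v w → ι (v A.⊕ w) ≡ ι v K.⊕ ι w
    ι-⊕ v w = ≡quad (+-homo _ _) (+-homo _ _) (+-homo _ _) (+-homo _ _)

    ι-· : ∀ k v → ι (k A.· v) ≡ h k K.· ι v
    ι-· k v = ≡quad (*-homo k _) (*-homo k _) (*-homo k _) (*-homo k _)

    ι-θ· : ∀ v → ι (A.θ· v) ≡ K.θ· (ι v)
    ι-θ· v = ≡quad (*-homo _ _) (homo _ _ _) (homo _ _ _) refl
      where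
      homo : ∀ x y z → h (x + (y * z)) ≡ h x +′ (h y *′ h z)
      homo x y z = trans (+-homo x _) (cong (h x +′_) (*-homo y z))

    ι-⊛ : ∀ v w → ι (v A.⊛ w) ≡ ι v K.⊛ ι w
    ι-⊛ v w = ⊕-homo (ι-· _ w) (⊕-homo (·-homo (ι-θ· w)) (⊕-homo (·-homo ι-θ²·) (·-homo (trans (ι-θ· _) (cong K.θ· ι-θ²·)))))
      where
      ι-θ²· : ι (A.θ· (A.θ· w)) ≡ K.θ· (K.θ· (ι w))
      ι-θ²· = trans (ι-θ· _) (cong K.θ· (ι-θ· w))
      ·-homo : ∀ {k u u′} → ι u ≡ u′ → ι (k A.· u) ≡ h k K.· u′
      ·-homo {k} eq = trans (ι-· k _) (cong (h k K.·_) eq)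
      ⊕-homo : ∀ {u v u′ v′} → ι u ≡ u′ → ι v ≡ v′ → ι (u A.⊕ v) ≡ u′ K.⊕ v′
      ⊕-homo eq₁ eq₂ = trans (ι-⊕ _ _) (cong₂ K._⊕_ eq₁ eq₂)

    ι-⊝ : ∀ v → ι (A.⊝ v) ≡ K.⊝ (ι v)
    ι-⊝ v = ≡quad (-‿homo _) (-‿homo _) (-‿homo _) (-‿homo _)

    ι-injective : ∀ {v w} → ι v ≡ ι w → v ≡ w
    ι-injective eq = ≡quad (injective (cong x₀ eq)) (injective (cong x₁ eq)) (injective (cong x₂ eq)) (injective (cong x₃ eq))

  ι-mono : IsRingMonomorphism (CommutativeRing.rawRing A.commutativeRing) (CommutativeRing.rawRing K.commutativeRing) ι
  ι-mono = record
    { isRingHomomorphism = record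
      { isSemiringHomomorphism = record
        { isNearSemiringHomomorphism = record
          { +-isMonoidHomomorphism = record
            { isMagmaHomomorphism = record
              { isRelHomomorphism = record { cong = cong ι }
              ; homo = ι-⊕ }
            ; ε-homo = trans (ι-const _) (cong K.const 0#-homo) }
          ; *-homo = ι-⊛ }
        ; 1#-homo = trans (ι-const _) (cong K.const 1#-homo) }
      ; -‿homo = ι-⊝ }
    ; injective = ι-injective }

-- The ring ℚ[T]/(f) and the order ℤ[θ]

module Order (α : ℤ) where

  open BaseChange ℤ.+-*-isCommutativeRing ℚ.+-*-isCommutativeRing ℤ→ℚ ℤ→ℚ-mono (+ 3) α (+ 6) public
  module A = Quartic ℤ.+-*-isCommutativeRing (+ 3) α (+ 6)
  module K = Quartic ℚ.+-*-isCommutativeRing (ℤ→ℚ (+ 3)) (ℤ→ℚ α) (ℤ→ℚ (+ 6))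
  module Kᵣ = CommutativeRing K.commutativeRing
  module Aᵣ = CommutativeRing A.commutativeRing

  f : Poly
  f = fα α

  -- class p is p(θ); it identifies ℚ[T]/(f) with K.
  open Evaluation K.commutativeRing K.const-homo K.θ public
    renaming (evalₚ to class; evalₚ-+ₚ to class-+ₚ; evalₚ-*ₚ to class-*ₚ; evalₚ-cong to class-cong; evalₚ-negₚ to class-negₚ)

  classℤ : List ℤ → Quad ℤ
  classℤ []       = A.𝟘
  classℤ (a ∷ cs) = A.const a A.⊕ A.θ A.⊛ classℤ cs

  class-ℤ : ∀ cs → class (ℤPoly→Poly cs) ≡ ι (classℤ cs)
  class-ℤ []       = sym (ι-const (+ 0))
  class-ℤ (a ∷ cs) = begin
    K.const (ℤ→ℚ a) K.⊕ K.θ K.⊛ class (ℤPoly→Poly cs)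
      ≡⟨ cong₂ K._⊕_ (sym (ι-const a)) (cong₂ K._⊛_ (sym ι-θ) (class-ℤ cs)) ⟩
    ι (A.const a) K.⊕ ι A.θ K.⊛ ι (classℤ cs)           ≡⟨ cong (ι (A.const a) K.⊕_) (ι-⊛ A.θ (classℤ cs)) ⟨
    ι (A.const a) K.⊕ ι (A.θ A.⊛ classℤ cs)             ≡⟨ ι-⊕ (A.const a) _ ⟨
    ι (classℤ (a ∷ cs))                                 ∎
    where open ≡-Reasoning

  class-compose : ∀ cs x → class (compose (ℤPoly→Poly cs) x) ≡ evalAt K.commutativeRing (λ c → ι (A.const c)) cs (class x)
  class-compose []       x = refl
  class-compose (c ∷ cs) x = begin
    class ([ ℤ→ℚ c ] +ₚ (x *ₚ compose (ℤPoly→Poly cs) x))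
      ≡⟨ class-+ₚ [ ℤ→ℚ c ] (x *ₚ compose (ℤPoly→Poly cs) x) ⟩
    class [ ℤ→ℚ c ] K.⊕ class (x *ₚ compose (ℤPoly→Poly cs) x)
      ≡⟨ cong₂ K._⊕_ (trans (cong (K.const (ℤ→ℚ c) K.⊕_) (Kᵣ.zeroʳ K.θ)) (trans (Kᵣ.+-identityʳ _) (sym (ι-const c))))
                     (trans (class-*ₚ x _) (cong (class x K.⊛_) (class-compose cs x))) ⟩
    evalAt K.commutativeRing (λ c → ι (A.const c)) (c ∷ cs) (class x) ∎
    where open ≡-Reasoning

  coordinates : Quad ℤ → List ℤ
  coordinates (quad a b c d) = a ∷ b ∷ c ∷ d ∷ []

  opaque
    unfolding QuadOps._⊛_

    classℤ-coordinates : ∀ v → classℤ (coordinates v) ≡ v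
    classℤ-coordinates (quad a b c d) =
      let open ℤ.+-*-Solver
          module P = QuadOps {Polynomial 5} _:+_ _:*_
          eq = λ (x : Quad (Polynomial 5) → Polynomial 5) α a b c d →
            let open P (con (+ 3)) α (con (+ 6))
                z = con (+ 0)
                k = λ u → quad u z z z
                t = quad z (con (+ 1)) z z
            in x (k a ⊕ t ⊛ (k b ⊕ t ⊛ (k c ⊕ t ⊛ (k d ⊕ t ⊛ k z)))) := x (quad a b c d)
      in ≡quad (solve 5 (eq x₀) refl α a b c d) (solve 5 (eq x₁) refl α a b c d)
               (solve 5 (eq x₂) refl α a b c d) (solve 5 (eq x₃) refl α a b c d)

    class-f : class f ≡ K.𝟘
    class-f = trans (class-ℤ fℤ) (trans (cong ι fℤ≡𝟘) (ι-const (+ 0)))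
      where
      fℤ : List ℤ
      fℤ = ℤ.- (+ 3) ∷ ℤ.- α ∷ ℤ.- (+ 6) ∷ + 0 ∷ + 1 ∷ []
      fℤ≡𝟘 : classℤ fℤ ≡ A.𝟘
      fℤ≡𝟘 =
        let open ℤ.+-*-Solver
            module P = QuadOps {Polynomial 1} _:+_ _:*_
            eq = λ (x : Quad (Polynomial 1) → Polynomial 1) α →
              let open P (con (+ 3)) α (con (+ 6))
                  z = con (+ 0)
                  k = λ u → quad u z z z
                  t = quad z (con (+ 1)) z z
              in x (k (con (ℤ.- (+ 3))) ⊕ t ⊛ (k (:- α) ⊕ t ⊛ (k (con (ℤ.- (+ 6))) ⊕ t ⊛ (k z ⊕ t ⊛ (k (con (+ 1)) ⊕ t ⊛ k z))))) := z
        in ≡quad (solve 1 (eq x₀) refl α) (solve 1 (eq x₁) refl α) (solve 1 (eq x₂) refl α) (solve 1 (eq x₃) refl α)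

  lift : Quad ℚ → Poly
  lift (quad a b c d) = a ∷ b ∷ c ∷ d ∷ []

  f∣⇒class≡𝟘 : ∀ p → f ∣ₚ p → class p ≡ K.𝟘
  f∣⇒class≡𝟘 p (q , p≈fq) = begin
    class p                ≡⟨ class-cong p (f *ₚ q) p≈fq ⟩
    class (f *ₚ q)         ≡⟨ class-*ₚ f q ⟩
    class f K.⊛ class q    ≡⟨ cong (K._⊛ class q) class-f ⟩
    K.𝟘 K.⊛ class q        ≡⟨ Kᵣ.zeroˡ (class q) ⟩
    K.𝟘                    ∎
    where open ≡-Reasoning

  opaque
    unfolding QuadOps._⊛_

    -- The polynomial a + T r(T) has degree at most 4 and leading coefficient `x₃ r`; subtracting
    -- `x₃ r` times f reduces it, and this is what `θ·` does to coordinates.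
    coeff-lift-∷ : ∀ a r k → coeff (lift (K.const a K.⊕ K.θ· r)) k ℚ.+ coeff f k ℚ.* x₃ r ≡ coeff (a ∷ lift r) k
    coeff-lift-∷ a (quad r₀ r₁ r₂ r₃) = λ where
        0 → solve 2 (λ a r₃ → a :+ con (+ 3) :* r₃ :+ con (ℤ.- (+ 3)) :* r₃ := a) refl a r₃
        1 → trans (cong (λ x → 0ℚ ℚ.+ (r₀ ℚ.+ ℤ→ℚ α ℚ.* r₃) ℚ.+ x ℚ.* r₃) (ℤ→ℚ-homo-neg α))
              (solve 3 (λ α r₀ r₃ → con (+ 0) :+ (r₀ :+ α :* r₃) :+ (:- α) :* r₃ := r₀) refl (ℤ→ℚ α) r₀ r₃)
        2 → solve 2 (λ r₁ r₃ → con (+ 0) :+ (r₁ :+ con (+ 6) :* r₃) :+ con (ℤ.- (+ 6)) :* r₃ := r₁) refl r₁ r₃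
        3 → solve 2 (λ r₂ r₃ → con (+ 0) :+ r₂ :+ con (+ 0) :* r₃ := r₂) refl r₂ r₃
        4 → trans (ℚ.+-identityˡ _) (ℚ.*-identityˡ r₃)
        (suc (suc (suc (suc (suc k))))) → trans (ℚ.+-identityˡ _) (ℚ.*-zeroˡ r₃)
      where open ℚ-Solver

  -- Division with remainder in the style of Horner: each step of `class` drops a multiple of f, and
  -- the multiplier `x₃ r` becomes the next coefficient of the quotient.
  divide-by-f : ∀ p → ∃[ q ] p ≈ₚ (f *ₚ q +ₚ lift (class p))
  divide-by-f []      = [] , zero-lift
    where
    zero-lift : ∀ k → 0ℚ ≡ coeff (f *ₚ [] +ₚ lift K.𝟘) k
    zero-lift 0 = refl
    zero-lift 1 = refl
    zero-lift 2 = refl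
    zero-lift 3 = refl
    zero-lift 4 = refl
    zero-lift (suc (suc (suc (suc (suc k))))) = refl
  divide-by-f (a ∷ p) with divide-by-f p
  ... | q , ih = (x₃ r ∷ q) , λ k → trans (step k)
          (trans (cong (λ v → coeff (f *ₚ (x₃ r ∷ q)) k ℚ.+ coeff (lift (K.const a K.⊕ v)) k) (sym (K.θ-⊛ r)))
                 (sym (coeff-+ₚ (f *ₚ (x₃ r ∷ q)) (lift (class (a ∷ p))) k)))
    where
    open ≡-Reasoning
    r = class p
    r′ = lift (K.const a K.⊕ K.θ· r)
    step : ∀ k → coeff (a ∷ p) k ≡ coeff (f *ₚ (x₃ r ∷ q)) k ℚ.+ coeff r′ k
    step zero    = begin
      a                                              ≡⟨ coeff-lift-∷ a r 0 ⟨
      coeff r′ 0 ℚ.+ coeff f 0 ℚ.* x₃ r              ≡⟨ ℚ.+-comm (coeff r′ 0) _ ⟩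
      coeff f 0 ℚ.* x₃ r ℚ.+ coeff r′ 0              ≡⟨ cong (ℚ._+ coeff r′ 0) (coeff-*ₚ-∷-zero f (x₃ r) q) ⟨
      coeff (f *ₚ (x₃ r ∷ q)) 0 ℚ.+ coeff r′ 0       ∎
    step (suc k) = begin
      coeff p k
        ≡⟨ ih k ⟩
      coeff (f *ₚ q +ₚ lift r) k
        ≡⟨ coeff-+ₚ (f *ₚ q) (lift r) k ⟩
      coeff (f *ₚ q) k ℚ.+ coeff (lift r) k
        ≡⟨ cong (coeff (f *ₚ q) k ℚ.+_) (coeff-lift-∷ a r (suc k)) ⟨
      coeff (f *ₚ q) k ℚ.+ (coeff r′ (suc k) ℚ.+ coeff f (suc k) ℚ.* x₃ r)
        ≡⟨ solve 3 (λ x y z → x :+ (y :+ z) := z :+ x :+ y) refl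
             (coeff (f *ₚ q) k) (coeff r′ (suc k)) (coeff f (suc k) ℚ.* x₃ r) ⟩
      coeff f (suc k) ℚ.* x₃ r ℚ.+ coeff (f *ₚ q) k ℚ.+ coeff r′ (suc k)
        ≡⟨ cong (ℚ._+ coeff r′ (suc k)) (coeff-*ₚ-∷-suc f (x₃ r) q k) ⟨
      coeff (f *ₚ (x₃ r ∷ q)) (suc k) ℚ.+ coeff r′ (suc k) ∎
      where open ℚ-Solver

  class≡𝟘⇒f∣ : ∀ p → class p ≡ K.𝟘 → f ∣ₚ p
  class≡𝟘⇒f∣ p p≡𝟘 with divide-by-f p
  ... | q , p≈ = q , λ k → begin
    coeff p k                                           ≡⟨ p≈ k ⟩
    coeff (f *ₚ q +ₚ lift (class p)) k                  ≡⟨ coeff-+ₚ (f *ₚ q) (lift (class p)) k ⟩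
    coeff (f *ₚ q) k ℚ.+ coeff (lift (class p)) k       ≡⟨ cong (λ v → coeff (f *ₚ q) k ℚ.+ coeff (lift v) k) p≡𝟘 ⟩
    coeff (f *ₚ q) k ℚ.+ coeff (lift K.𝟘) k             ≡⟨ cong (coeff (f *ₚ q) k ℚ.+_) (lift-𝟘 k) ⟩
    coeff (f *ₚ q) k ℚ.+ 0ℚ                             ≡⟨ ℚ.+-identityʳ _ ⟩
    coeff (f *ₚ q) k                                    ∎
    where
    open ≡-Reasoning
    lift-𝟘 : ∀ k → coeff (lift K.𝟘) k ≡ 0ℚ
    lift-𝟘 0 = refl
    lift-𝟘 1 = refl
    lift-𝟘 2 = refl
    lift-𝟘 3 = refl
    lift-𝟘 (suc (suc (suc (suc k)))) = refl

  -- Coefficients pass through ℤ[θ], the shape that `integral⇒∣power` expects.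
  evalAtK : List ℤ → Quad ℚ → Quad ℚ
  evalAtK = evalAt K.commutativeRing (λ c → ι (A.const c))

  IntegralK : Quad ℚ → Set
  IntegralK w = ∃[ cs ] evalAtK (cs ++ [ + 1 ]) w ≡ K.𝟘

  integralMod⇒ : ∀ x → IntegralMod f x → IntegralK (class x)
  integralMod⇒ x (cs , f∣) = cs ,
    trans (sym (class-compose (cs ++ [ + 1 ]) x)) (f∣⇒class≡𝟘 (compose (ℤPoly→Poly (cs ++ [ + 1 ])) x) f∣)

  integralMod⇐ : ∀ x → IntegralK (class x) → IntegralMod f x
  integralMod⇐ x (cs , eq) = cs ,
    class≡𝟘⇒f∣ (compose (ℤPoly→Poly (cs ++ [ + 1 ])) x) (trans (class-compose (cs ++ [ + 1 ]) x) eq)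

  class--ₚ : ∀ p q → class (p -ₚ q) ≡ class p K.⊕ K.⊝ class q
  class--ₚ p q = trans (class-+ₚ p (negₚ q)) (cong (class p K.⊕_) (class-negₚ q))

  inℤ[θ]⇒ : ∀ x → InℤAdjoinMod f x → ∃[ v ] class x ≡ ι v
  inℤ[θ]⇒ x (y , f∣) = classℤ y , trans (GroupProperties.x∙y⁻¹≈ε⇒x≈y Kᵣ.+-group _ _
    (trans (sym (class--ₚ x (ℤPoly→Poly y))) (f∣⇒class≡𝟘 (x -ₚ ℤPoly→Poly y) f∣))) (class-ℤ y)

  inℤ[θ]⇐ : ∀ x v → class x ≡ ι v → InℤAdjoinMod f x
  inℤ[θ]⇐ x v x≡v = coordinates v , class≡𝟘⇒f∣ (x -ₚ ℤPoly→Poly (coordinates v)) (begin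
    class (x -ₚ ℤPoly→Poly (coordinates v))                ≡⟨ class--ₚ x (ℤPoly→Poly (coordinates v)) ⟩
    class x K.⊕ K.⊝ class (ℤPoly→Poly (coordinates v))
      ≡⟨ cong (λ u → class x K.⊕ K.⊝ u) (trans (class-ℤ (coordinates v)) (trans (cong ι (classℤ-coordinates v)) (sym x≡v))) ⟩
    class x K.⊕ K.⊝ class x                                ≡⟨ Kᵣ.-‿inverseʳ (class x) ⟩
    K.𝟘                                                    ∎)
    where open ≡-Reasoning

-- Primes

module _ {p : ℕ} (pr : Prime p) where

  prime∣*⇒∣⊎∣ : ∀ a b → + p Signed.∣ a ℤ.* b → + p Signed.∣ a ⊎ + p Signed.∣ b
  prime∣*⇒∣⊎∣ a b p∣ab with euclidsLemma ℤ.∣ a ∣ ℤ.∣ b ∣ pr (subst (p ℕ.∣_) (ℤ.abs-* a b) (Signed.∣⇒∣ᵤ p∣ab))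
  ... | inj₁ p∣a = inj₁ (Signed.∣ᵤ⇒∣ p∣a)
  ... | inj₂ p∣b = inj₂ (Signed.∣ᵤ⇒∣ p∣b)

  prime∣²⇒∣ : ∀ a → + p Signed.∣ a ℤ.* a → + p Signed.∣ a
  prime∣²⇒∣ a p∣a² with prime∣*⇒∣⊎∣ a a p∣a²
  ... | inj₁ p∣a = p∣a
  ... | inj₂ p∣a = p∣a

  prime∤1 : ¬ (+ p Signed.∣ + 1)
  prime∤1 p∣1 = ¬prime[1] (subst Prime (ℕ.∣1⇒≡1 (Signed.∣⇒∣ᵤ p∣1)) pr)

-- Explicit identities in ℤ[θ]

module Arithmetic (α : ℤ) where
  open Order α public

  valueAt : ℤ → ℤ
  valueAt τ = τ ℤ.* τ ℤ.* τ ℤ.* τ ℤ.- + 6 ℤ.* (τ ℤ.* τ) ℤ.- α ℤ.* τ ℤ.- + 3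

  -- θ ↦ τ, a ring homomorphism modulo f(τ).
  ρ : ℤ → Quad ℤ → ℤ
  ρ τ v = x₀ v ℤ.+ τ ℤ.* (x₁ v ℤ.+ τ ℤ.* (x₂ v ℤ.+ τ ℤ.* x₃ v))

  linear : ℤ → Quad ℤ
  linear τ = quad (ℤ.- τ) (+ 1) (+ 0) (+ 0)

  -- Synthetic division of v(T) by T - τ; the remainder is v(τ).
  linear-quotient : ℤ → Quad ℤ → Quad ℤ
  linear-quotient τ v = quad (x₁ v ℤ.+ τ ℤ.* (x₂ v ℤ.+ τ ℤ.* x₃ v)) (x₂ v ℤ.+ τ ℤ.* x₃ v) (x₃ v) (+ 0)

  -- The value at τ of the quotient of the polynomial v(T) w(T) by f, that is, what ρ fails to see
  -- when θ⁴ is reduced.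
  carry : ℤ → Quad ℤ → Quad ℤ → ℤ
  carry τ v w = x₁ v ℤ.* x₃ w ℤ.+ x₂ v ℤ.* (x₂ w ℤ.+ τ ℤ.* x₃ w) ℤ.+
    x₃ v ℤ.* (x₁ w ℤ.+ + 6 ℤ.* x₃ w ℤ.+ τ ℤ.* (x₂ w ℤ.+ τ ℤ.* x₃ w))

  opaque
    unfolding QuadOps._⊛_

    ρ-+ : ∀ τ v w → ρ τ (v A.⊕ w) ≡ ρ τ v ℤ.+ ρ τ w
    ρ-+ τ (quad a b c d) (quad a' b' c' d') =
      solve 9 (λ τ a b c d a' b' c' d' →
        (a :+ a') :+ τ :* ((b :+ b') :+ τ :* ((c :+ c') :+ τ :* (d :+ d'))) :=
        (a :+ τ :* (b :+ τ :* (c :+ τ :* d))) :+ (a' :+ τ :* (b' :+ τ :* (c' :+ τ :* d')))) refl τ a b c d a' b' c' d'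
      where open ℤ.+-*-Solver

    ρ-* : ∀ τ v w → ρ τ v ℤ.* ρ τ w ≡ ρ τ (v A.⊛ w) ℤ.+ carry τ v w ℤ.* valueAt τ
    ρ-* τ (quad a b c d) (quad a' b' c' d') =
      let open ℤ.+-*-Solver
          module P = QuadOps {Polynomial 10} _:+_ _:*_
          ρ : Polynomial 10 → Quad (Polynomial 10) → Polynomial 10
          ρ = λ τ v → x₀ v :+ τ :* (x₁ v :+ τ :* (x₂ v :+ τ :* x₃ v))
      in solve 10 (λ α τ a b c d a' b' c' d' →
        let open P (con (+ 3)) α (con (+ 6))
            v = quad a b c d
            w = quad a' b' c' d'
        in ρ τ v :* ρ τ w := ρ τ (v ⊛ w) :+
             (b :* d' :+ c :* (c' :+ τ :* d') :+ d :* (b' :+ con (+ 6) :* d' :+ τ :* (c' :+ τ :* d'))) :*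
             (τ :* τ :* τ :* τ :- con (+ 6) :* (τ :* τ) :- α :* τ :- con (+ 3))) refl α τ a b c d a' b' c' d'

    ρ-const : ∀ τ k → ρ τ (A.const k) ≡ k
    ρ-const = solve 2 (λ τ k → k :+ τ :* (con (+ 0) :+ τ :* (con (+ 0) :+ τ :* con (+ 0))) := k) refl
      where open ℤ.+-*-Solver

    divide-linear : ∀ τ v → v ≡ A.const (ρ τ v) A.⊕ linear τ A.⊛ linear-quotient τ v
    divide-linear τ (quad a b c d) =
      let open ℤ.+-*-Solver
          module P = QuadOps {Polynomial 6} _:+_ _:*_
          eq = λ (x : Quad (Polynomial 6) → Polynomial 6) α τ a b c d →
            let open P (con (+ 3)) α (con (+ 6))
                z = con (+ 0)
            in x (quad a b c d) := x (quad (a :+ τ :* (b :+ τ :* (c :+ τ :* d))) z z z ⊕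
                 quad (:- τ) (con (+ 1)) z z ⊛ quad (b :+ τ :* (c :+ τ :* d)) (c :+ τ :* d) d z)
      in ≡quad (solve 6 (eq x₀) refl α τ a b c d) (solve 6 (eq x₁) refl α τ a b c d)
               (solve 6 (eq x₂) refl α τ a b c d) (solve 6 (eq x₃) refl α τ a b c d)

    ⊛-coordinates : ∀ k a b c d → A.const k A.⊛ quad a b c d ≡ quad (k ℤ.* a) (k ℤ.* b) (k ℤ.* c) (k ℤ.* d)
    ⊛-coordinates k a b c d = A.const-⊛ k _

  const-* : ∀ k l → A.const (k ℤ.* l) ≡ A.const k A.⊛ A.const l
  const-* = IsRingHomomorphism.*-homo A.const-homo

  ρ-linear : ∀ τ σ → ρ σ (linear τ) ≡ σ ℤ.- τ
  ρ-linear = solve 2 (λ τ σ → (:- τ) :+ σ :* (con (+ 1) :+ σ :* (con (+ 0) :+ σ :* con (+ 0))) := σ :- τ) refl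
    where open ℤ.+-*-Solver

  ρ-mθ : ∀ τ m → ρ τ (quad (+ 0) m (+ 0) (+ 0)) ≡ τ ℤ.* m
  ρ-mθ = solve 2 (λ τ m → con (+ 0) :+ τ :* (m :+ τ :* (con (+ 0) :+ τ :* con (+ 0))) := τ :* m) refl
    where open ℤ.+-*-Solver

  opaque
    unfolding QuadOps._⊛_

    -- f = (T ∓ 1)³(T ± 3) − (α ± 8) T.
    cube-split₊ : linear (+ 1) A.⊛ linear (+ 1) A.⊛ linear (+ 1) A.⊛ linear (ℤ.- (+ 3)) ≡ quad (+ 0) (α ℤ.+ + 8) (+ 0) (+ 0)
    cube-split₊ =
      let open ℤ.+-*-Solver
          module P = QuadOps {Polynomial 1} _:+_ _:*_
          k : ℤ → Polynomial 1
          k = con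
          eq = λ (x : Quad (Polynomial 1) → Polynomial 1) α →
            let open P (con (+ 3)) α (con (+ 6))
                S = quad (k (ℤ.- (+ 1))) (k (+ 1)) (k (+ 0)) (k (+ 0))
                S′ = quad (k (+ 3)) (k (+ 1)) (k (+ 0)) (k (+ 0))
            in x (S ⊛ S ⊛ S ⊛ S′) := x (quad (k (+ 0)) (α :+ k (+ 8)) (k (+ 0)) (k (+ 0)))
      in ≡quad (solve 1 (eq x₀) refl α) (solve 1 (eq x₁) refl α) (solve 1 (eq x₂) refl α) (solve 1 (eq x₃) refl α)

    cube-split₋ : linear (ℤ.- (+ 1)) A.⊛ linear (ℤ.- (+ 1)) A.⊛ linear (ℤ.- (+ 1)) A.⊛ linear (+ 3) ≡
      quad (+ 0) (α ℤ.- + 8) (+ 0) (+ 0)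
    cube-split₋ =
      let open ℤ.+-*-Solver
          module P = QuadOps {Polynomial 1} _:+_ _:*_
          k : ℤ → Polynomial 1
          k = con
          eq = λ (x : Quad (Polynomial 1) → Polynomial 1) α →
            let open P (con (+ 3)) α (con (+ 6))
                S = quad (k (+ 1)) (k (+ 1)) (k (+ 0)) (k (+ 0))
                S′ = quad (k (ℤ.- (+ 3))) (k (+ 1)) (k (+ 0)) (k (+ 0))
            in x (S ⊛ S ⊛ S ⊛ S′) := x (quad (k (+ 0)) (α :- k (+ 8)) (k (+ 0)) (k (+ 0)))
      in ≡quad (solve 1 (eq x₀) refl α) (solve 1 (eq x₁) refl α) (solve 1 (eq x₂) refl α) (solve 1 (eq x₃) refl α)

    θ⁴ : linear (+ 0) A.⊛ linear (+ 0) A.⊛ linear (+ 0) A.⊛ linear (+ 0) ≡ quad (+ 3) α (+ 6) (+ 0)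
    θ⁴ =
      let open ℤ.+-*-Solver
          module P = QuadOps {Polynomial 1} _:+_ _:*_
          k : ℤ → Polynomial 1
          k = con
          eq = λ (x : Quad (Polynomial 1) → Polynomial 1) α →
            let open P (con (+ 3)) α (con (+ 6))
                S = quad (k (+ 0)) (k (+ 1)) (k (+ 0)) (k (+ 0))
            in x (S ⊛ S ⊛ S ⊛ S) := x (quad (k (+ 3)) α (k (+ 6)) (k (+ 0)))
      in ≡quad (solve 1 (eq x₀) refl α) (solve 1 (eq x₁) refl α) (solve 1 (eq x₂) refl α) (solve 1 (eq x₃) refl α)

  -- The square of a polynomial y(T) of degree at most 3 is f quotient(y) + r with r = y², and f′, derivative
  -- are formal derivatives.
  quotient derivative : Quad ℤ → Quad ℤ
  quotient (quad a b c d) = quad (+ 2 ℤ.* b ℤ.* d ℤ.+ c ℤ.* c ℤ.+ + 6 ℤ.* d ℤ.* d) (+ 2 ℤ.* c ℤ.* d) (d ℤ.* d) (+ 0)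
  derivative (quad a b c d) = quad b (+ 2 ℤ.* c) (+ 3 ℤ.* d) (+ 0)

  f′ : Quad ℤ
  f′ = quad (ℤ.- α) (ℤ.- (+ 12)) (+ 0) (+ 4)

  opaque
    unfolding QuadOps._⊛_

    -- (y²)′ = (f q + r)′ at θ.
    derivative-square : ∀ y → derivative y A.⊛ y A.⊕ derivative y A.⊛ y ≡ f′ A.⊛ quotient y A.⊕ derivative (y A.⊛ y)
    derivative-square (quad a b c d) =
      let open ℤ.+-*-Solver
          module P = QuadOps {Polynomial 5} _:+_ _:*_
          k : ℕ → Polynomial 5
          k = λ n → con (+ n)
          D : Quad (Polynomial 5) → Quad (Polynomial 5)
          D = λ v → quad (x₁ v) (k 2 :* x₂ v) (k 3 :* x₃ v) (k 0)
          eq = λ (x : Quad (Polynomial 5) → Polynomial 5) α a b c d →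
            let open P (con (+ 3)) α (con (+ 6))
                y = quad a b c d
                q = quad (k 2 :* b :* d :+ c :* c :+ k 6 :* d :* d) (k 2 :* c :* d) (d :* d) (k 0)
            in x (D y ⊛ y ⊕ D y ⊛ y) := x (quad (:- α) (con (ℤ.- (+ 12))) (k 0) (k 4) ⊛ q ⊕ D (y ⊛ y))
      in ≡quad (solve 5 (eq x₀) refl α a b c d) (solve 5 (eq x₁) refl α a b c d)
               (solve 5 (eq x₂) refl α a b c d) (solve 5 (eq x₃) refl α a b c d)

    -- The first factor is 3 (α² − 64) / f′(θ).
    f′-norm : quad (ℤ.- (+ 3 ℤ.* α)) (ℤ.- (+ 28)) (+ 0) (+ 4) A.⊛ f′ ≡ A.const (+ 3 ℤ.* ((α ℤ.- + 8) ℤ.* (α ℤ.+ + 8)))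
    f′-norm =
      let open ℤ.+-*-Solver
          module P = QuadOps {Polynomial 1} _:+_ _:*_
          k : ℕ → Polynomial 1
          k = λ n → con (+ n)
          eq = λ (x : Quad (Polynomial 1) → Polynomial 1) α →
            let open P (con (+ 3)) α (con (+ 6))
            in x (quad (:- (k 3 :* α)) (con (ℤ.- (+ 28))) (k 0) (k 4) ⊛ quad (:- α) (con (ℤ.- (+ 12))) (k 0) (k 4))
               := x (quad (k 3 :* ((α :- k 8) :* (α :+ k 8))) (k 0) (k 0) (k 0))
      in ≡quad (solve 1 (eq x₀) refl α) (solve 1 (eq x₁) refl α) (solve 1 (eq x₂) refl α) (solve 1 (eq x₃) refl α)

    linear-square : ∀ a b → quad a b (+ 0) (+ 0) A.⊛ quad a b (+ 0) (+ 0) ≡ quad (a ℤ.* a) (+ 2 ℤ.* a ℤ.* b) (b ℤ.* b) (+ 0)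
    linear-square a b =
      let open ℤ.+-*-Solver
          module P = QuadOps {Polynomial 3} _:+_ _:*_
          k : ℕ → Polynomial 3
          k = λ n → con (+ n)
          eq = λ (x : Quad (Polynomial 3) → Polynomial 3) α a b →
            let open P (con (+ 3)) α (con (+ 6))
                y = quad a b (k 0) (k 0)
            in x (y ⊛ y) := x (quad (a :* a) (k 2 :* a :* b) (b :* b) (k 0))
      in ≡quad (solve 3 (eq x₀) refl α a b) (solve 3 (eq x₁) refl α a b)
               (solve 3 (eq x₂) refl α a b) (solve 3 (eq x₃) refl α a b)

    split₃ : ∀ a b c d → quad a b c d ≡ quad (+ 0) (+ 0) (+ 0) d A.⊕ quad a b c (+ 0)
    split₃ a b c d = ≡quad (sym (ℤ.+-identityˡ a)) (sym (ℤ.+-identityˡ b)) (sym (ℤ.+-identityˡ c)) (sym (ℤ.+-identityʳ d))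

    split₂ : ∀ a b c → quad a b c (+ 0) ≡ quad (+ 0) (+ 0) c (+ 0) A.⊕ quad a b (+ 0) (+ 0)
    split₂ a b c = ≡quad (sym (ℤ.+-identityˡ a)) (sym (ℤ.+-identityˡ b)) (sym (ℤ.+-identityʳ c)) refl

-- Primes of ℤ[θ] above p

module LocalOrder (α : ℤ) {p : ℕ} (pr : Prime p) where
  open Arithmetic α
  open LocalCriterion A.commutativeRing
  open Exponentiation Aᵣ.semiring using (_^_)

  π : Quad ℤ
  π = A.const (+ p)

  module _ (τ : ℤ) (p∣f[τ] : + p Signed.∣ valueAt τ) where

    -- The kernel of the ring homomorphism ℤ[θ] → 𝔽_p with θ ↦ τ. By `ρ-*` the map ρ is
    -- multiplicative up to multiples of f(τ), which vanish modulo p.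
    root⇒primeIdeal : PrimeIdeal
    root⇒primeIdeal = record
      { _∈P = λ v → + p Signed.∣ ρ τ v
      ; ∈-resp-≈ = λ { refl p∣ → p∣ }
      ; ∈-+-cancelˡ = λ {a} {b} p∣a p∣a+b → Signed.∣m+n∣m⇒∣n (subst (+ p Signed.∣_) (ρ-+ τ a b) p∣a+b) p∣a
      ; ∈-*ʳ = λ {a} b p∣a → Signed.∣m+n∣n⇒∣m (subst (+ p Signed.∣_) (ρ-* τ a b) (Signed.∣m⇒∣m*n (ρ τ b) p∣a))
          (Signed.∣n⇒∣m*n (carry τ a b) p∣f[τ])
      ; ∈-prime = λ a b p∣ab → prime∣*⇒∣⊎∣ pr (ρ τ a) (ρ τ b)
          (subst (+ p Signed.∣_) (sym (ρ-* τ a b)) (Signed.∣m∣n⇒∣m+n p∣ab (Signed.∣n⇒∣m*n (carry τ a b) p∣f[τ])))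
      ; 1∉P = λ p∣1 → prime∤1 pr (subst (+ p Signed.∣_) (ρ-const τ (+ 1)) p∣1)
      }

  root-generated : ∀ τ v → + p Signed.∣ ρ τ v → ∃[ t ] ∃[ y ] v ≡ π A.⊛ t A.⊕ linear τ A.⊛ y
  root-generated τ v (divides q eq) = A.const q , linear-quotient τ v ,
    trans (divide-linear τ v) (cong (A._⊕ (linear τ A.⊛ linear-quotient τ v))
      (trans (cong A.const (trans eq (ℤ.*-comm q (+ p)))) (const-* (+ p) q)))

  p∣ρ-linear : ∀ τ → + p Signed.∣ ρ τ (linear τ)
  p∣ρ-linear τ = subst (+ p Signed.∣_) (sym (trans (ρ-linear τ τ) (ℤ.+-inverseʳ τ))) (divides (+ 0) refl)

  ramified⇒divides : ∀ τ τ′ g {v} → IntegralQuotient π v →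
    linear τ A.⊛ linear τ A.⊛ linear τ A.⊛ linear τ′ ≡ π A.⊛ g →
    + p Signed.∣ valueAt τ → + p Signed.∣ valueAt τ′ → ¬ (+ p Signed.∣ ρ τ g) →
    ¬ (+ p Signed.∣ ρ τ′ g) ⊎ ¬ (+ p Signed.∣ τ′ ℤ.- τ) → ∃[ t ] v ≡ π A.⊛ t
  ramified⇒divides τ τ′ g v/π S³S′≡πg p∣τ p∣τ′ p∤g outside =
    regular⇒divides v/π (root⇒primeIdeal τ p∣τ) (root⇒primeIdeal τ′ p∣τ′) S³S′≡πg
      (p∣ρ-π τ) (p∣ρ-linear τ) (p∣ρ-π τ′) (p∣ρ-linear τ′) (root-generated τ) (root-generated τ′) p∤g (outside′ outside)
    where
    p∣ρ-π : ∀ σ → + p Signed.∣ ρ σ π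
    p∣ρ-π σ = subst (+ p Signed.∣_) (sym (ρ-const σ (+ p))) (divides (+ 1) (sym (ℤ.*-identityˡ (+ p))))
    outside′ : ¬ (+ p Signed.∣ ρ τ′ g) ⊎ ¬ (+ p Signed.∣ τ′ ℤ.- τ) → ¬ (+ p Signed.∣ ρ τ′ g) ⊎ ¬ (+ p Signed.∣ ρ τ′ (linear τ))
    outside′ (inj₁ p∤) = inj₁ p∤
    outside′ (inj₂ p∤) = inj₂ λ p∣ → p∤ (subst (+ p Signed.∣_) (ρ-linear τ τ′) p∣)

  infix 4 π∣_
  π∣_ : Quad ℤ → Set
  π∣ v = ∃[ t ] v ≡ π A.⊛ t

  open NaturalSolver Aᵣ.commutativeSemiring using ()
    renaming (solve to solveA; _:+_ to infixl 6 _⊞_; _:*_ to infixl 7 _⊠_; _:=_ to infix 4 _⊜_)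

  π∣-+ : ∀ {v w} → π∣ v → π∣ w → π∣ v A.⊕ w
  π∣-+ (s , refl) (t , refl) = s A.⊕ t , sym (Aᵣ.distribˡ π s t)

  π∣-*ˡ : ∀ u {v} → π∣ v → π∣ u A.⊛ v
  π∣-*ˡ u (t , refl) = u A.⊛ t , solveA 3 (λ u π t → u ⊠ (π ⊠ t) ⊜ π ⊠ (u ⊠ t)) refl u π t

  π∣-+-cancelˡ : ∀ {v w} → π∣ v → π∣ v A.⊕ w → π∣ w
  π∣-+-cancelˡ {v} {w} (s , refl) (t , eq) = t A.⊕ A.⊝ s , (begin
    w                                              ≡⟨ Aᵣ.+-identityˡ w ⟨
    A.𝟘 A.⊕ w                                      ≡⟨ cong (A._⊕ w) (Aᵣ.-‿inverseˡ (π A.⊛ s)) ⟨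
    A.⊝ (π A.⊛ s) A.⊕ π A.⊛ s A.⊕ w                ≡⟨ Aᵣ.+-assoc _ _ w ⟩
    A.⊝ (π A.⊛ s) A.⊕ (π A.⊛ s A.⊕ w)              ≡⟨ cong₂ A._⊕_ (RingProperties.-‿distribʳ-* Aᵣ.ring π s) eq ⟩
    π A.⊛ (A.⊝ s) A.⊕ π A.⊛ t                      ≡⟨ Aᵣ.+-comm _ (π A.⊛ t) ⟩
    π A.⊛ t A.⊕ π A.⊛ (A.⊝ s)                      ≡⟨ Aᵣ.distribˡ π t (A.⊝ s) ⟨
    π A.⊛ (t A.⊕ A.⊝ s)                            ∎)
    where open ≡-Reasoning

  ∣coordinates⇒π∣ : ∀ {a b c d} → + p Signed.∣ a → + p Signed.∣ b → + p Signed.∣ c → + p Signed.∣ d → π∣ quad a b c d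
  ∣coordinates⇒π∣ (divides a refl) (divides b refl) (divides c refl) (divides d refl) = quad a b c d ,
    trans (≡quad (ℤ.*-comm a (+ p)) (ℤ.*-comm b (+ p)) (ℤ.*-comm c (+ p)) (ℤ.*-comm d (+ p))) (sym (⊛-coordinates (+ p) a b c d))

  π∣⇒∣coordinate : (x : Quad ℤ → ℤ) → (∀ t → x (π A.⊛ t) ≡ + p ℤ.* x t) → ∀ {v} → π∣ v → + p Signed.∣ x v
  π∣⇒∣coordinate x eq (t , refl) = divides (x t) (trans (eq t) (ℤ.*-comm (+ p) (x t)))

  π∣⇒∣₀ : ∀ {v} → π∣ v → + p Signed.∣ x₀ v
  π∣⇒∣₀ = π∣⇒∣coordinate x₀ (λ t → cong x₀ (⊛-coordinates (+ p) _ _ _ _))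

  π∣⇒∣₁ : ∀ {v} → π∣ v → + p Signed.∣ x₁ v
  π∣⇒∣₁ = π∣⇒∣coordinate x₁ (λ t → cong x₁ (⊛-coordinates (+ p) _ _ _ _))

  π∣⇒∣₂ : ∀ {v} → π∣ v → + p Signed.∣ x₂ v
  π∣⇒∣₂ = π∣⇒∣coordinate x₂ (λ t → cong x₂ (⊛-coordinates (+ p) _ _ _ _))

  π∣⇒∣₃ : ∀ {v} → π∣ v → + p Signed.∣ x₃ v
  π∣⇒∣₃ = π∣⇒∣coordinate x₃ (λ t → cong x₃ (⊛-coordinates (+ p) _ _ _ _))

  π∣-cancel-const : ∀ k → ¬ (+ p Signed.∣ k) → ∀ v → π∣ A.const k A.⊛ v → π∣ v
  π∣-cancel-const k p∤k v@(quad a b c d) π∣kv = ∣coordinates⇒π∣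
    (cancel (subst (+ p Signed.∣_) (cong x₀ kv≡) (π∣⇒∣₀ π∣kv))) (cancel (subst (+ p Signed.∣_) (cong x₁ kv≡) (π∣⇒∣₁ π∣kv)))
    (cancel (subst (+ p Signed.∣_) (cong x₂ kv≡) (π∣⇒∣₂ π∣kv))) (cancel (subst (+ p Signed.∣_) (cong x₃ kv≡) (π∣⇒∣₃ π∣kv)))
    where
    kv≡ = ⊛-coordinates k a b c d
    cancel : ∀ {x} → + p Signed.∣ k ℤ.* x → + p Signed.∣ x
    cancel {x} p∣kx with prime∣*⇒∣⊎∣ pr k x p∣kx
    ... | inj₁ p∣k = ⊥-elim (p∤k p∣k)
    ... | inj₂ p∣x = p∣x

  -- From (u + v)² = (u + 2v) u + v². It discards coordinates already known to be divisible by p.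
  π∣-square-summand : ∀ u v → π∣ u → π∣ (u A.⊕ v) A.⊛ (u A.⊕ v) → π∣ v A.⊛ v
  π∣-square-summand u v π∣u π∣² = π∣-+-cancelˡ (π∣-*ˡ (u A.⊕ v A.⊕ v) π∣u)
    (subst π∣_ (solveA 2 (λ u v → (u ⊞ v) ⊠ (u ⊞ v) ⊜ (u ⊞ v ⊞ v) ⊠ u ⊞ v ⊠ v) refl u v) π∣²)

  -- Primes not dividing the discriminant

  module Unramified (p∤ : ¬ (+ p Signed.∣ + 3 ℤ.* ((α ℤ.- + 8) ℤ.* (α ℤ.+ + 8)))) where

    π∣-cancel-f′ : ∀ v → π∣ f′ A.⊛ v → π∣ v
    π∣-cancel-f′ v π∣f′v = π∣-cancel-const _ p∤ v (subst π∣_ (trans (sym (Aᵣ.*-assoc _ f′ v)) (cong (A._⊛ v) f′-norm))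
      (π∣-*ˡ _ π∣f′v))

    -- quotient y has smaller degree than y, so that iterating this reaches a constant.
    quotient-square : ∀ y → π∣ y A.⊛ y → π∣ quotient y A.⊛ quotient y
    -- Modulo p, 2 y′ y = f′ q. Multiplying by y gives f′ q y = 2 y′ y² = 0, so q y = 0 after
    -- cancelling f′; multiplying by q then gives f′ q² = 2 y′ q y = 0. Nothing is divided by 2, so
    -- p = 2 is covered.
    quotient-square y π∣y² = π∣-cancel-f′ _ (π∣-+-cancelˡ (π∣-*ˡ q π∣r′) (subst π∣_ eq₂ (π∣-*ˡ y′ (π∣-+ π∣qy π∣qy))))
      where
      y′ = derivative y
      q  = quotient y
      r′ = derivative (y A.⊛ y)
      π∣r′ : π∣ r′
      π∣r′ = ∣coordinates⇒π∣ (π∣⇒∣₁ π∣y²) (Signed.∣n⇒∣m*n (+ 2) (π∣⇒∣₂ π∣y²)) (Signed.∣n⇒∣m*n (+ 3) (π∣⇒∣₃ π∣y²)) (divides (+ 0) refl)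
      expand : ∀ z → y′ A.⊛ (z A.⊛ y A.⊕ z A.⊛ y) ≡ z A.⊛ r′ A.⊕ f′ A.⊛ (q A.⊛ z)
      expand z = begin
        y′ A.⊛ (z A.⊛ y A.⊕ z A.⊛ y)             ≡⟨ solveA 3 (λ y′ z y → y′ ⊠ (z ⊠ y ⊞ z ⊠ y) ⊜ z ⊠ (y′ ⊠ y ⊞ y′ ⊠ y)) refl y′ z y ⟩
        z A.⊛ (y′ A.⊛ y A.⊕ y′ A.⊛ y)            ≡⟨ cong (z A.⊛_) (derivative-square y) ⟩
        z A.⊛ (f′ A.⊛ q A.⊕ r′)                  ≡⟨ solveA 4 (λ z f′ q r′ → z ⊠ (f′ ⊠ q ⊞ r′) ⊜ z ⊠ r′ ⊞ f′ ⊠ (q ⊠ z)) refl z f′ q r′ ⟩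
        z A.⊛ r′ A.⊕ f′ A.⊛ (q A.⊛ z)            ∎
        where open ≡-Reasoning
      π∣qy : π∣ q A.⊛ y
      π∣qy = π∣-cancel-f′ _ (π∣-+-cancelˡ (π∣-*ˡ y π∣r′) (subst π∣_ (expand y) (π∣-*ˡ y′ (π∣-+ π∣y² π∣y²))))
      eq₂ = expand q

    ∣-const-square : ∀ k → π∣ A.const k A.⊛ A.const k → + p Signed.∣ k
    ∣-const-square k π∣k² = prime∣²⇒∣ pr k (subst (+ p Signed.∣_) (cong x₀ (sym (const-* k k))) (π∣⇒∣₀ π∣k²))

    -- The square of a + bT + cT² has degree at most 4, so its quotient by f is the constant c², and
    -- p divides the square of this constant.
    quadratic-square⇒∣₂ : ∀ a b c → π∣ quad a b c (+ 0) A.⊛ quad a b c (+ 0) → + p Signed.∣ c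
    quadratic-square⇒∣₂ a b c π∣y² = prime∣²⇒∣ pr c (∣-const-square (c ℤ.* c)
      (subst (λ q → π∣ q A.⊛ q) quotient≡ (quotient-square _ π∣y²)))
      where
      quotient≡ : quotient (quad a b c (+ 0)) ≡ A.const (c ℤ.* c)
      quotient≡ = ≡quad
        (solve 2 (λ b c → con (+ 2) :* b :* con (+ 0) :+ c :* c :+ con (+ 6) :* con (+ 0) :* con (+ 0) := c :* c) refl b c)
        (ℤ.*-zeroʳ (+ 2 ℤ.* c)) refl refl
        where open ℤ.+-*-Solver

    -- For d, the quotient of y² has degree at most 2 with T²-coefficient d², so the quadratic case
    -- applies to it. Once dT³ and then cT² are discarded, the square of a + bT needs no reduction
    -- by f and shows a² and b² among its coordinates.
    reduced : ∀ y → π∣ y A.⊛ y → π∣ y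
    reduced (quad a b c d) π∣y² = ∣coordinates⇒π∣ p∣a p∣b p∣c p∣d
      where
      0∣ : + p Signed.∣ + 0
      0∣ = divides (+ 0) refl
      p∣d = prime∣²⇒∣ pr d (quadratic-square⇒∣₂ _ _ (d ℤ.* d) (quotient-square _ π∣y²))
      π∣² = π∣-square-summand _ _ (∣coordinates⇒π∣ 0∣ 0∣ 0∣ p∣d) (subst (λ y → π∣ y A.⊛ y) (split₃ a b c d) π∣y²)
      p∣c = quadratic-square⇒∣₂ a b c π∣²
      π∣¹ = subst π∣_ (linear-square a b)
        (π∣-square-summand _ _ (∣coordinates⇒π∣ 0∣ 0∣ p∣c 0∣) (subst (λ y → π∣ y A.⊛ y) (split₂ a b c) π∣²))
      p∣a = prime∣²⇒∣ pr a (π∣⇒∣₀ π∣¹)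
      p∣b = prime∣²⇒∣ pr b (π∣⇒∣₂ π∣¹)

    nilpotent⇒π∣ : ∀ y n → π∣ y ^ n → π∣ y
    nilpotent⇒π∣ y zero          π∣1 = subst π∣_ (Aᵣ.*-identityʳ y) (π∣-*ˡ y π∣1)
    nilpotent⇒π∣ y (suc zero)    π∣y = subst π∣_ (Aᵣ.*-identityʳ y) π∣y
    nilpotent⇒π∣ y (suc (suc n)) π∣yⁿ⁺² = nilpotent⇒π∣ y (suc n) (reduced (y ^ suc n)
      (subst π∣_ (solveA 2 (λ y yⁿ → yⁿ ⊠ (y ⊠ (y ⊠ yⁿ)) ⊜ (y ⊠ yⁿ) ⊠ (y ⊠ yⁿ)) refl y (y ^ n)) (π∣-*ˡ (y ^ n) π∣yⁿ⁺²)))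

    unramified⇒divides : ∀ {v} → IntegralQuotient π v → π∣ v
    unramified⇒divides {v} v/π = let n , vⁿ = v/π {π} {v} refl in nilpotent⇒π∣ v n vⁿ

-- The ramified primes

module _ {p : ℕ} (pr : Prime p) where

  squareFree⇒∤cofactor : ∀ {n} → SquareFree n → ∀ m → n ≡ m ℤ.* + p → ¬ (+ p Signed.∣ m)
  squareFree⇒∤cofactor sf m n≡mp (divides k m≡kp) = sf p pr (Signed.∣⇒∣ᵤ (divides k
    (trans n≡mp (trans (cong (ℤ._* + p) m≡kp) (ℤ.*-assoc k (+ p) (+ p))))))

  prime∤* : ∀ {a b} → ¬ (+ p Signed.∣ a) → ¬ (+ p Signed.∣ b) → ¬ (+ p Signed.∣ a ℤ.* b)
  prime∤* {a} {b} p∤a p∤b p∣ab with prime∣*⇒∣⊎∣ pr a b p∣ab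
  ... | inj₁ p∣a = p∤a p∣a
  ... | inj₂ p∣b = p∤b p∣b

  ∣3⇒∤4 : + p Signed.∣ + 3 → ¬ (+ p Signed.∣ + 4)
  ∣3⇒∤4 p∣3 p∣4 = prime∤1 pr (Signed.∣m+n∣m⇒∣n p∣4 p∣3)

  ∣3⇒≡3 : + p Signed.∣ + 3 → p ≡ 3
  ∣3⇒≡3 p∣3 with prime⇒irreducible (from-yes (prime? 3)) (Signed.∣⇒∣ᵤ p∣3)
  ... | inj₁ refl = ⊥-elim (¬prime[1] pr)
  ... | inj₂ p≡3  = p≡3

  ∣-neg⇒∣ : ∀ {a} → + p Signed.∣ ℤ.- a → + p Signed.∣ a
  ∣-neg⇒∣ {a} p∣-a = subst (+ p Signed.∣_) (ℤ.neg-involutive a) (Signed.∣m⇒∣-m p∣-a)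

  module _ (α : ℤ) where
    open Arithmetic α
    open LocalOrder α pr
    open LocalCriterion A.commutativeRing using (IntegralQuotient)

    π⊛mθ : ∀ {n} m → n ≡ m ℤ.* + p → quad (+ 0) n (+ 0) (+ 0) ≡ π A.⊛ quad (+ 0) m (+ 0) (+ 0)
    π⊛mθ m n≡mp = sym (trans (⊛-coordinates (+ p) _ _ _ _)
      (≡quad (ℤ.*-zeroʳ (+ p)) (trans (ℤ.*-comm (+ p) m) (sym n≡mp)) (ℤ.*-zeroʳ (+ p)) (ℤ.*-zeroʳ (+ p))))

    -- Applied with n = α ± 8 = p m: then g = m θ, which θ ↦ τ sends to τ m, so squarefreeness of n
    -- decides whether g avoids the prime.
    ramified-mθ : ∀ τ τ′ {n} m {v} → IntegralQuotient π v → n ≡ m ℤ.* + p →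
      linear τ A.⊛ linear τ A.⊛ linear τ A.⊛ linear τ′ ≡ quad (+ 0) n (+ 0) (+ 0) →
      + p Signed.∣ valueAt τ → + p Signed.∣ valueAt τ′ → ¬ (+ p Signed.∣ τ ℤ.* m) →
      ¬ (+ p Signed.∣ τ′ ℤ.* m) ⊎ ¬ (+ p Signed.∣ τ′ ℤ.- τ) → π∣ v
    ramified-mθ τ τ′ m v/π n≡mp S³S′≡ p∣τ p∣τ′ p∤τm outside =
      ramified⇒divides τ τ′ (quad (+ 0) m (+ 0) (+ 0)) v/π (trans S³S′≡ (π⊛mθ m n≡mp)) p∣τ p∣τ′
        (λ p∣ → p∤τm (subst (+ p Signed.∣_) (ρ-mθ τ m) p∣)) (outside′ outside)
      where
      outside′ : ¬ (+ p Signed.∣ τ′ ℤ.* m) ⊎ ¬ (+ p Signed.∣ τ′ ℤ.- τ) →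
        ¬ (+ p Signed.∣ ρ τ′ (quad (+ 0) m (+ 0) (+ 0))) ⊎ ¬ (+ p Signed.∣ τ′ ℤ.- τ)
      outside′ (inj₁ p∤) = inj₁ λ p∣ → p∤ (subst (+ p Signed.∣_) (ρ-mθ τ′ m) p∣)
      outside′ (inj₂ p∤) = inj₂ p∤

    divides₊ : SquareFree (α ℤ.+ + 8) → + p Signed.∣ α ℤ.+ + 8 → ∀ {v} → IntegralQuotient π v → π∣ v
    divides₊ sf (divides m eq) v/π = ramified-mθ (+ 1) (ℤ.- (+ 3)) m v/π eq cube-split₊
      (divides (ℤ.- m) (trans
        (solve 1 (λ α → con (+ 1) :- con (+ 6) :* con (+ 1) :- α :* con (+ 1) :- con (+ 3) := :- (α :+ con (+ 8))) refl α)
        (trans (cong ℤ.-_ eq) (ℤ.neg-distribˡ-* m (+ p)))))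
      (divides (+ 3 ℤ.* m) (trans
        (solve 1 (λ α → con (+ 81) :- con (+ 6) :* con (+ 9) :- α :* con (ℤ.- (+ 3)) :- con (+ 3) := con (+ 3) :* (α :+ con (+ 8))) refl α)
        (trans (cong (+ 3 ℤ.*_) eq) (sym (ℤ.*-assoc (+ 3) m (+ p))))))
      (λ p∣ → p∤m (subst (+ p Signed.∣_) (ℤ.*-identityˡ m) p∣)) outside
      where
      open ℤ.+-*-Solver
      p∤m = squareFree⇒∤cofactor sf m eq
      outside : ¬ (+ p Signed.∣ ℤ.- (+ 3) ℤ.* m) ⊎ ¬ (+ p Signed.∣ ℤ.- (+ 4))
      -- At p = 3 the value -3 m of g vanishes, but -3 and 1 are then distinct roots because 3 does
      -- not divide 4. For other p the value is nonzero; this includes p = 2, where the two primes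
      -- coincide.
      outside with + p Signed.∣? + 3
      ... | yes p∣3 = inj₂ λ p∣-4 → ∣3⇒∤4 p∣3 (∣-neg⇒∣ p∣-4)
      ... | no  p∤3 = inj₁ (prime∤* (λ p∣-3 → p∤3 (∣-neg⇒∣ p∣-3)) p∤m)

    -- The mirror image of `divides₊` under T ↦ -T and α ↦ -α, which preserves f.
    divides₋ : SquareFree (α ℤ.- + 8) → + p Signed.∣ α ℤ.- + 8 → ∀ {v} → IntegralQuotient π v → π∣ v
    divides₋ sf (divides m eq) v/π = ramified-mθ (ℤ.- (+ 1)) (+ 3) m v/π eq cube-split₋
      (divides m (trans
        (solve 1 (λ α → con (+ 1) :- con (+ 6) :* con (+ 1) :- α :* con (ℤ.- (+ 1)) :- con (+ 3) := α :- con (+ 8)) refl α) eq))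
      (divides (ℤ.- (+ 3) ℤ.* m) (trans
        (solve 1 (λ α → con (+ 81) :- con (+ 6) :* con (+ 9) :- α :* con (+ 3) :- con (+ 3) := con (ℤ.- (+ 3)) :* (α :- con (+ 8))) refl α)
        (trans (cong (ℤ.- (+ 3) ℤ.*_) eq) (sym (ℤ.*-assoc (ℤ.- (+ 3)) m (+ p))))))
      (λ p∣ → p∤m (∣-neg⇒∣ (subst (+ p Signed.∣_) (ℤ.-1*i≡-i m) p∣))) outside
      where
      open ℤ.+-*-Solver
      p∤m = squareFree⇒∤cofactor sf m eq
      outside : ¬ (+ p Signed.∣ + 3 ℤ.* m) ⊎ ¬ (+ p Signed.∣ + 4)
      outside with + p Signed.∣? + 3
      ... | yes p∣3 = inj₂ (∣3⇒∤4 p∣3)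
      ... | no  p∤3 = inj₁ (prime∤* p∤3 p∤m)

module _ (α : ℤ) where
  open Arithmetic α
  open LocalCriterion A.commutativeRing using (IntegralQuotient)

  -- In this case f is Eisenstein at 3: θ⁴ = 3 (1 + β θ + 2 θ²), and θ ↦ 0 sends the cofactor to 1.
  -- Both primes of the criterion are (3, θ).
  divides₃ : (pr : Prime 3) → ∀ β → α ≡ β ℤ.* + 3 → ∀ {v} → IntegralQuotient (A.const (+ 3)) v → LocalOrder.π∣_ α pr v
  divides₃ pr β α≡3β v/π = ramified⇒divides (+ 0) (+ 0) (quad (+ 1) β (+ 2) (+ 0)) v/π
      (trans θ⁴ (sym (trans (⊛-coordinates (+ 3) _ _ _ _) (≡quad refl (trans (ℤ.*-comm (+ 3) β) (sym α≡3β)) refl refl))))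
      3∣f[0] 3∣f[0] (λ 3∣1 → prime∤1 pr 3∣1) (inj₁ λ 3∣1 → prime∤1 pr 3∣1)
    where
    open LocalOrder α pr
    3∣f[0] : + 3 Signed.∣ valueAt (+ 0)
    3∣f[0] = divides (ℤ.- (+ 1)) (cong (λ x → + 0 ℤ.- x ℤ.- + 3) (ℤ.*-zeroʳ α))

  module _ (sf₋ : SquareFree (α ℤ.- + 8)) (sf₊ : SquareFree (α ℤ.+ + 8)) where

    integralQuotient⇒divides : ∀ {p} (pr : Prime p) {v} → IntegralQuotient (A.const (+ p)) v → LocalOrder.π∣_ α pr v
    integralQuotient⇒divides {p} pr v/π with + p Signed.∣? α ℤ.+ + 8
    ... | yes p∣α+8 = divides₊ pr α sf₊ p∣α+8 v/π
    ... | no  p∤α+8 with + p Signed.∣? α ℤ.- + 8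
    ...   | yes p∣α-8 = divides₋ pr α sf₋ p∣α-8 v/π
    ...   | no  p∤α-8 with + p Signed.∣? + 3
    ...     | no p∤3 = LocalOrder.Unramified.unramified⇒divides α pr (prime∤* pr p∤3 (prime∤* pr p∤α-8 p∤α+8)) v/π
    ...     | yes p∣3 with ∣3⇒≡3 pr p∣3
    -- According to α modulo 3, one of α, α + 8 and α - 8 is divisible by 3; the last two are
    -- excluded by now.
    ...       | refl with α ℤ.%ℕ 3 | α ℤ./ℕ 3 | ℤ.a≡a%ℕn+[a/ℕn]*n α 3 | ℤ.n%ℕd<d α 3
    ...         | 0 | q | eq | _ = divides₃ pr q (trans eq (ℤ.+-identityˡ _)) v/π
    ...         | 1 | q | eq | _ = ⊥-elim (p∤α+8 (divides (q ℤ.+ + 3) (trans (cong (ℤ._+ + 8) eq)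
                  (solve 1 (λ q → con (+ 1) :+ q :* con (+ 3) :+ con (+ 8) := (q :+ con (+ 3)) :* con (+ 3)) refl q))))
                  where open ℤ.+-*-Solver
    ...         | 2 | q | eq | _ = ⊥-elim (p∤α-8 (divides (q ℤ.- + 2) (trans (cong (ℤ._- + 8) eq)
                  (solve 1 (λ q → con (+ 2) :+ q :* con (+ 3) :- con (+ 8) := (q :- con (+ 2)) :* con (+ 3)) refl q))))
                  where open ℤ.+-*-Solver
    ...         | suc (suc (suc _)) | _ | _ | ℕ.s≤s (ℕ.s≤s (ℕ.s≤s ()))

-- Removing denominators of integral elements

module IntegrallyClosed (α : ℤ) (sf₋ : SquareFree (α ℤ.- + 8)) (sf₊ : SquareFree (α ℤ.+ + 8)) where
  open Order α
  open Integrality A.commutativeRing K.commutativeRing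

  common-denominator : ∀ w → ∃[ D ] ∃[ v ] ℕ.NonZero D × ι (A.const (+ D)) K.⊛ w ≡ ι v
  common-denominator (quad a b c d) = D , v , nonZero , trans (cong (K._⊛ quad a b c d) (ι-const (+ D)))
      (trans (K-coordinates (ℤ→ℚ (+ D)) a b c d)
        (trans (≡quad (cleared a-cleared) (cleared b-cleared) (cleared c-cleared) (cleared d-cleared)) (sym (ι-quad v))))
    where
    D = ℚ.↧ₙ a ℕ.* (ℚ.↧ₙ b ℕ.* (ℚ.↧ₙ c ℕ.* ℚ.↧ₙ d))
    nonZero : ℕ.NonZero D
    nonZero = ℕ.m*n≢0 (ℚ.↧ₙ a) _ {{_}} {{ℕ.m*n≢0 (ℚ.↧ₙ b) _ {{_}} {{ℕ.m*n≢0 (ℚ.↧ₙ c) (ℚ.↧ₙ d)}}}}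
    a-cleared : D Clears a
    a-cleared = clears-*ʳ (ℚ.↧ₙ b ℕ.* (ℚ.↧ₙ c ℕ.* ℚ.↧ₙ d)) (↧ₙ-clears a)
    b-cleared : D Clears b
    b-cleared = clears-*ˡ (ℚ.↧ₙ a) (clears-*ʳ (ℚ.↧ₙ c ℕ.* ℚ.↧ₙ d) (↧ₙ-clears b))
    c-cleared : D Clears c
    c-cleared = clears-*ˡ (ℚ.↧ₙ a) (clears-*ˡ (ℚ.↧ₙ b) (clears-*ʳ (ℚ.↧ₙ d) (↧ₙ-clears c)))
    d-cleared : D Clears d
    d-cleared = clears-*ˡ (ℚ.↧ₙ a) (clears-*ˡ (ℚ.↧ₙ b) (clears-*ˡ (ℚ.↧ₙ c) (↧ₙ-clears d)))
    v = quad (numerator a-cleared) (numerator b-cleared) (numerator c-cleared) (numerator d-cleared)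
    opaque
      unfolding QuadOps._⊛_
      K-coordinates : ∀ k a b c d → K.const k K.⊛ quad a b c d ≡ quad (k ℚ.* a) (k ℚ.* b) (k ℚ.* c) (k ℚ.* d)
      K-coordinates k a b c d = K.const-⊛ k _

  const-cancelˡ : ∀ D {{_ : ℕ.NonZero D}} v w → ι (A.const (+ D)) K.⊛ v ≡ ι (A.const (+ D)) K.⊛ w → v ≡ w
  const-cancelˡ D v w Dv≡Dw = trans (sym (cancel v)) (trans (cong (K.const r K.⊛_) Dv≡Dw) (cancel w))
    where
    inverse = ℚ-inverse (ℤ→ℚ (+ D)) (λ D≡0 → ℕ.≢-nonZero⁻¹ D (ℤ.+-injective (ℤ→ℚ-injective D≡0)))
    r = proj₁ inverse
    cancel : ∀ v → K.const r K.⊛ (ι (A.const (+ D)) K.⊛ v) ≡ v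
    cancel v = begin
      K.const r K.⊛ (ι (A.const (+ D)) K.⊛ v)          ≡⟨ Kᵣ.*-assoc (K.const r) (ι (A.const (+ D))) v ⟨
      K.const r K.⊛ ι (A.const (+ D)) K.⊛ v            ≡⟨ cong (λ x → K.const r K.⊛ x K.⊛ v) (ι-const (+ D)) ⟩
      K.const r K.⊛ K.const (ℤ→ℚ (+ D)) K.⊛ v          ≡⟨ cong (K._⊛ v) (IsRingHomomorphism.*-homo K.const-homo r (ℤ→ℚ (+ D))) ⟨
      K.const (r ℚ.* ℤ→ℚ (+ D)) K.⊛ v                  ≡⟨ cong (λ x → K.const x K.⊛ v) (proj₂ inverse) ⟩
      K.𝟙 K.⊛ v                                        ≡⟨ K.⊛-identityˡ v ⟩
      v                                                ∎
      where open ≡-Reasoning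

  ι-const-* : ∀ p D → ι (A.const (+ (p ℕ.* D))) ≡ ι (A.const (+ p)) K.⊛ ι (A.const (+ D))
  ι-const-* p D = begin
    ι (A.const (+ (p ℕ.* D)))                       ≡⟨ ι-const _ ⟩
    K.const (ℤ→ℚ (+ (p ℕ.* D)))                     ≡⟨ cong (λ x → K.const (ℤ→ℚ x)) (ℤ.pos-* p D) ⟩
    K.const (ℤ→ℚ (+ p ℤ.* + D))                     ≡⟨ cong K.const (ℤ→ℚ-homo-* (+ p) (+ D)) ⟩
    K.const (ℤ→ℚ (+ p) ℚ.* ℤ→ℚ (+ D))               ≡⟨ IsRingHomomorphism.*-homo K.const-homo _ _ ⟩
    K.const (ℤ→ℚ (+ p)) K.⊛ K.const (ℤ→ℚ (+ D))     ≡⟨ cong₂ K._⊛_ (ι-const (+ p)) (ι-const (+ D)) ⟨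
    ι (A.const (+ p)) K.⊛ ι (A.const (+ D))         ∎
    where open ≡-Reasoning

  remove-primes : ∀ ps → All Prime ps → ∀ {w} → IntegralK w → ∀ v → ι (A.const (+ product ps)) K.⊛ w ≡ ι v → ∃[ u ] w ≡ ι u
  remove-primes []       []         {w} _ v Dw≡v = v , trans (sym (trans (cong (K._⊛ w) (ι-const (+ 1))) (K.⊛-identityˡ w))) Dw≡v
  remove-primes (p ∷ ps) (pr ∷ prs) {w} w-integral@(cs , root) v Dw≡v =
      remove-primes ps prs w-integral v′ (const-cancelˡ p {{prime⇒nonZero pr}} _ _ (begin
        ιp K.⊛ (ιD K.⊛ w)        ≡⟨ Kᵣ.*-assoc ιp ιD w ⟨
        ιp K.⊛ ιD K.⊛ w          ≡⟨ cong (K._⊛ w) (ι-const-* p (product ps)) ⟨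
        ι (A.const (+ product (p ∷ ps))) K.⊛ w ≡⟨ Dw≡v ⟩
        ι v                      ≡⟨ cong ι (proj₂ π∣v) ⟩
        ι (π A.⊛ v′)             ≡⟨ ι-⊛ π v′ ⟩
        ιp K.⊛ ι v′              ∎))
    where
    open ≡-Reasoning
    open LocalOrder α pr
    open LocalCriterion A.commutativeRing using (IntegralQuotient)
    ιp = ι (A.const (+ p))
    D = A.const (+ product ps)
    ιD = ι D
    v/π : IntegralQuotient π v
    -- This avoids proving that v / π = D w is integral as a product: s v = π u means (s D) w = u,
    -- so the equation of `w` itself shows that s D, and with it s, divides a power of u.
    v/π {s} {u} sv≡πu = let n , t , uⁿ≡ = integral⇒∣power ι-mono refl {s A.⊛ D} {u} {w} {cs} sDw≡u root
                        in n , D A.⊛ t , trans uⁿ≡ (A.⊛-assoc s D t)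
      where
      sDw≡u : ι (s A.⊛ D) K.⊛ w ≡ ι u
      sDw≡u = const-cancelˡ p {{prime⇒nonZero pr}} _ _ (begin
        ιp K.⊛ (ι (s A.⊛ D) K.⊛ w)          ≡⟨ cong (λ x → ιp K.⊛ (x K.⊛ w)) (ι-⊛ s D) ⟩
        ιp K.⊛ (ι s K.⊛ ιD K.⊛ w)           ≡⟨ solve 4 (λ p s D w → p :* (s :* D :* w) := s :* (p :* D :* w)) refl ιp (ι s) ιD w ⟩
        ι s K.⊛ (ιp K.⊛ ιD K.⊛ w)           ≡⟨ cong (λ x → ι s K.⊛ (x K.⊛ w)) (ι-const-* p (product ps)) ⟨
        ι s K.⊛ (ι (A.const (+ product (p ∷ ps))) K.⊛ w) ≡⟨ cong (ι s K.⊛_) Dw≡v ⟩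
        ι s K.⊛ ι v                         ≡⟨ ι-⊛ s v ⟨
        ι (s A.⊛ v)                         ≡⟨ cong ι sv≡πu ⟩
        ι (π A.⊛ u)                         ≡⟨ ι-⊛ π u ⟩
        ιp K.⊛ ι u                          ∎)
        where open NaturalSolver Kᵣ.commutativeSemiring
    π∣v : π∣ v
    π∣v = integralQuotient⇒divides α sf₋ sf₊ pr v/π
    v′ = proj₁ π∣v

  integral⇒inι : ∀ w → IntegralK w → ∃[ u ] w ≡ ι u
  integral⇒inι w w-integral = remove-primes factors factorsPrime w-integral v
      (subst (λ D → ι (A.const (+ D)) K.⊛ w ≡ ι v) isFactorisation Dw≡v)
    where
    common = common-denominator w
    D = proj₁ common
    v = proj₁ (proj₂ common)
    D≢0 = proj₁ (proj₂ (proj₂ common))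
    Dw≡v = proj₂ (proj₂ (proj₂ common))
    open PrimeFactorisation (factorise D {{D≢0}})

-- Integrality of the elements of ℤ[θ]

module Integers (α : ℤ) where
  open Order α
  open Summation Aᵣ.semiring using (sum)

  coordinate : Fin 4 → Quad ℤ → ℤ
  coordinate fzero                      = x₃
  coordinate (fsuc fzero)               = x₂
  coordinate (fsuc (fsuc fzero))        = x₁
  coordinate (fsuc (fsuc (fsuc fzero))) = x₀

  -- In decreasing order, so that the elimination leaves the coordinate along 1.
  θ^ : Fin 4 → Quad ℤ
  θ^ fzero                      = quad (+ 0) (+ 0) (+ 0) (+ 1)
  θ^ (fsuc fzero)               = quad (+ 0) (+ 0) (+ 1) (+ 0)
  θ^ (fsuc (fsuc fzero))        = A.θ
  θ^ (fsuc (fsuc (fsuc fzero))) = A.𝟙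

  opaque
    unfolding QuadOps._⊛_

    coordinate-expansion : ∀ v → sum (λ k → A.const (coordinate k v) A.⊛ θ^ k) ≡ v
    coordinate-expansion (quad a b c d) =
      let open ℤ.+-*-Solver
          module P = QuadOps {Polynomial 5} _:+_ _:*_
          eq = λ (x : Quad (Polynomial 5) → Polynomial 5) α a b c d →
            let open P (con (+ 3)) α (con (+ 6))
                z = con (+ 0)
                o = con (+ 1)
                k = λ u → quad u z z z
            in x (k d ⊛ quad z z z o ⊕ (k c ⊛ quad z z o z ⊕ (k b ⊛ quad z o z z ⊕ (k a ⊛ quad o z z z ⊕ k z)))) := x (quad a b c d)
      in ≡quad (solve 5 (eq x₀) refl α a b c d) (solve 5 (eq x₁) refl α a b c d)
               (solve 5 (eq x₂) refl α a b c d) (solve 5 (eq x₃) refl α a b c d)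

  opaque
    -- Multiplication by u preserves the ℤ-span of the powers of θ; the matrix is the one of -u in
    -- this basis.
    everywhere-integral : ∀ u → ∃[ cs ] evalAt A.commutativeRing A.const (cs ++ [ + 1 ]) u ≡ A.𝟘
    everywhere-integral u = Elimination.matrix⇒integral A.commutativeRing A.const-homo u 3 θ^
      (λ i k → coordinate k (A.⊝ (u A.⊛ θ^ i))) refl (λ i → coordinate-expansion (A.⊝ (u A.⊛ θ^ i)))

  ι-integral : ∀ v → IntegralK (ι v)
  ι-integral v = let cs , root = everywhere-integral v in cs , trans
    (evalAt-homo A.commutativeRing K.commutativeRing (IsRingMonomorphism.isRingHomomorphism ι-mono) A.const (cs ++ [ + 1 ]) v)
    (trans (cong ι root) (ι-const (+ 0)))

  ringOfIntegers : SquareFree (α ℤ.- + 8) → SquareFree (α ℤ.+ + 8) → RingOfIntegersIsℤ[θ] f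
  ringOfIntegers sf₋ sf₊ x = integral⇒inℤ[θ] , inℤ[θ]⇒integral
    where
    integral⇒inℤ[θ] : IntegralMod f x → InℤAdjoinMod f x
    integral⇒inℤ[θ] x-integral =
      let v , x≡v = IntegrallyClosed.integral⇒inι α sf₋ sf₊ (class x) (integralMod⇒ x x-integral)
      in inℤ[θ]⇐ x v x≡v
    inℤ[θ]⇒integral : InℤAdjoinMod f x → IntegralMod f x
    inℤ[θ]⇒integral x∈ =
      let v , x≡v = inℤ[θ]⇒ x x∈
      in integralMod⇐ x (subst IntegralK (sym x≡v) (ι-integral v))

-- Irreducibility

evaluationAt : ℚ → Poly → ℚ
evaluationAt r = Evaluation.evalₚ ℚ.+-*-commutativeRing (Identity.isRingHomomorphism ℚ.+-*-rawRing refl) r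

linear⇒root : ∀ p → coeff p 1 ≢ 0ℚ → VanishesAbove 1 (coeff p) → ∃[ r ] evaluationAt r p ≡ 0ℚ
linear⇒root p p₁≢0 vanishes with ℚ-inverse (coeff p 1) p₁≢0
... | u , up₁≡1 = r , trans (Evaluation.evalₚ-cong ℚ.+-*-commutativeRing _ r p (p₀ ∷ p₁ ∷ []) p≈) (begin
    p₀ ℚ.+ r ℚ.* (p₁ ℚ.+ r ℚ.* 0ℚ)
      ≡⟨ solve 3 (λ p₀ p₁ u → p₀ :+ :- (p₀ :* u) :* (p₁ :+ :- (p₀ :* u) :* con (+ 0)) := p₀ :+ :- p₀ :* (u :* p₁)) refl p₀ p₁ u ⟩
    p₀ ℚ.+ ℚ.- p₀ ℚ.* (u ℚ.* p₁)    ≡⟨ cong (λ x → p₀ ℚ.+ ℚ.- p₀ ℚ.* x) up₁≡1 ⟩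
    p₀ ℚ.+ ℚ.- p₀ ℚ.* 1ℚ            ≡⟨ solve 1 (λ p₀ → p₀ :+ :- p₀ :* con (+ 1) := con (+ 0)) refl p₀ ⟩
    0ℚ                              ∎)
  where
  open ≡-Reasoning
  open ℚ-Solver
  p₀ = coeff p 0
  p₁ = coeff p 1
  r = ℚ.- (p₀ ℚ.* u)
  p≈ : p ≈ₚ (p₀ ∷ p₁ ∷ [])
  p≈ 0             = refl
  p≈ 1             = refl
  p≈ (suc (suc k)) = vanishes (suc (suc k)) (ℕ.s≤s (ℕ.s≤s ℕ.z≤n))

-- For (p₀ + p₁ T + p₂ T²)(q₀ + q₁ T + q₂ T²) monic without cubic term, a = p₁ q₂ and b = p₀ q₂ are the
-- coefficients of the monic first factor.
module QuadraticFactor {p₀ p₁ p₂ q₀ q₁ q₂ : ℚ} (cubic : p₁ ℚ.* q₂ ℚ.+ p₂ ℚ.* q₁ ≡ 0ℚ) (monic : p₂ ℚ.* q₂ ≡ 1ℚ) where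
  open ≡-Reasoning
  open ℚ-Solver

  a = p₁ ℚ.* q₂
  b = p₀ ℚ.* q₂
  f₀ = p₀ ℚ.* q₀
  f₁ = p₀ ℚ.* q₁ ℚ.+ p₁ ℚ.* q₀
  f₂ = p₀ ℚ.* q₂ ℚ.+ p₁ ℚ.* q₁ ℚ.+ p₂ ℚ.* q₀

  private
    w≡0 : p₂ ℚ.* q₂ ℚ.- 1ℚ ≡ 0ℚ
    w≡0 = cong (ℚ._- 1ℚ) monic

  -- The cofactor of T² + aT + b is T² - aT + (a² + f₂ - b). This and `linear-term` compare the two
  -- lowest coefficients of the product.
  constant-term : b ℚ.* (a ℚ.* a ℚ.+ f₂ ℚ.- b) ≡ f₀
  constant-term = begin
    b ℚ.* (a ℚ.* a ℚ.+ f₂ ℚ.- b)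
      -- The two sides differ by a combination of the cubic coefficient u and of w = p₂ q₂ - 1, both
      -- zero; x and y below are the multipliers.
      ≡⟨ solve 6 (λ p₀ p₁ p₂ q₀ q₁ q₂ →
           let u = p₁ :* q₂ :+ p₂ :* q₁
               w = p₂ :* q₂ :- con (+ 1)
           in p₀ :* q₂ :* (p₁ :* q₂ :* (p₁ :* q₂) :+ (p₀ :* q₂ :+ p₁ :* q₁ :+ p₂ :* q₀) :- p₀ :* q₂) :=
              p₀ :* q₀ :+ (p₀ :* q₂ :* p₁ :* q₂ :* u :+ (p₀ :* q₀ :- p₀ :* q₂ :* p₁ :* q₁) :* w)) refl p₀ p₁ p₂ q₀ q₁ q₂ ⟩
    f₀ ℚ.+ (x ℚ.* (p₁ ℚ.* q₂ ℚ.+ p₂ ℚ.* q₁) ℚ.+ y ℚ.* (p₂ ℚ.* q₂ ℚ.- 1ℚ))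
      ≡⟨ cong₂ (λ u w → f₀ ℚ.+ (x ℚ.* u ℚ.+ y ℚ.* w)) cubic w≡0 ⟩
    f₀ ℚ.+ (x ℚ.* 0ℚ ℚ.+ y ℚ.* 0ℚ)
      ≡⟨ solve 3 (λ f x y → f :+ (x :* con (+ 0) :+ y :* con (+ 0)) := f) refl f₀ x y ⟩
    f₀ ∎
    where
    x = p₀ ℚ.* q₂ ℚ.* p₁ ℚ.* q₂
    y = p₀ ℚ.* q₀ ℚ.- p₀ ℚ.* q₂ ℚ.* p₁ ℚ.* q₁

  linear-term : a ℚ.* (a ℚ.* a ℚ.+ f₂ ℚ.- b ℚ.- b) ≡ f₁
  linear-term = begin
    a ℚ.* (a ℚ.* a ℚ.+ f₂ ℚ.- b ℚ.- b)
      ≡⟨ solve 6 (λ p₀ p₁ p₂ q₀ q₁ q₂ →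
           let u = p₁ :* q₂ :+ p₂ :* q₁
               w = p₂ :* q₂ :- con (+ 1)
           in p₁ :* q₂ :* (p₁ :* q₂ :* (p₁ :* q₂) :+ (p₀ :* q₂ :+ p₁ :* q₁ :+ p₂ :* q₀) :- p₀ :* q₂ :- p₀ :* q₂) :=
              p₀ :* q₁ :+ p₁ :* q₀ :+ ((p₁ :* q₂ :* p₁ :* q₂ :- p₀ :* q₂) :* u :+
                (p₁ :* q₀ :+ p₀ :* q₁ :- p₁ :* q₂ :* p₁ :* q₁) :* w)) refl p₀ p₁ p₂ q₀ q₁ q₂ ⟩
    f₁ ℚ.+ (x ℚ.* (p₁ ℚ.* q₂ ℚ.+ p₂ ℚ.* q₁) ℚ.+ y ℚ.* (p₂ ℚ.* q₂ ℚ.- 1ℚ))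
      ≡⟨ cong₂ (λ u w → f₁ ℚ.+ (x ℚ.* u ℚ.+ y ℚ.* w)) cubic w≡0 ⟩
    f₁ ℚ.+ (x ℚ.* 0ℚ ℚ.+ y ℚ.* 0ℚ)
      ≡⟨ solve 3 (λ f x y → f :+ (x :* con (+ 0) :+ y :* con (+ 0)) := f) refl f₁ x y ⟩
    f₁ ∎
    where
    x = p₁ ℚ.* q₂ ℚ.* p₁ ℚ.* q₂ ℚ.- p₀ ℚ.* q₂
    y = p₁ ℚ.* q₀ ℚ.+ p₀ ℚ.* q₁ ℚ.- p₁ ℚ.* q₂ ℚ.* p₁ ℚ.* q₁

∣i∣≡n⇒i≡±n : ∀ i {n} → ℤ.∣ i ∣ ≡ n → i ≡ + n ⊎ i ≡ ℤ.- (+ n)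
∣i∣≡n⇒i≡±n (+ _)       refl = inj₁ refl
∣i∣≡n⇒i≡±n (ℤ.-[1+ _ ]) refl = inj₂ refl

divisor-of-3 : ∀ z w → ℤ.- (+ 3) ℤ.+ z ℤ.* w ≡ + 0 → (z ≡ + 1 ⊎ z ≡ ℤ.- (+ 1)) ⊎ (z ≡ + 3 ⊎ z ≡ ℤ.- (+ 3))
divisor-of-3 z w eq = Sum.map (∣i∣≡n⇒i≡±n z) (∣i∣≡n⇒i≡±n z)
  (prime⇒irreducible (from-yes (prime? 3)) (Signed.∣⇒∣ᵤ (divides w (trans 3≡zw (ℤ.*-comm z w)))))
  where
  3≡zw : + 3 ≡ z ℤ.* w
  3≡zw = trans (sym (cong (ℤ._+_ (+ 3)) eq)) (trans (sym (ℤ.+-assoc (+ 3) (ℤ.- (+ 3)) (z ℤ.* w))) (ℤ.+-identityˡ (z ℤ.* w)))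

square≢8 : ∀ z → z ℤ.* z ≢ + 8
square≢8 z z²≡8 = go ℤ.∣ z ∣ (trans (sym (ℤ.abs-* z z)) (cong ℤ.∣_∣ z²≡8))
  where
  go : ∀ n → n ℕ.* n ≢ 8
  go 0 ()
  go 1 ()
  go 2 ()
  go n@(suc (suc (suc k))) n²≡8 = ℕ.<-irrefl (sym n²≡8) (ℕ.*-mono-≤ {3} {n} {3} {n} 3≤n 3≤n)
    where
    3≤n : 3 ℕ.≤ n
    3≤n = ℕ.s≤s (ℕ.s≤s (ℕ.s≤s ℕ.z≤n))

module Irreducible (α : ℤ) (sf₋ : SquareFree (α ℤ.- + 8)) (sf₊ : SquareFree (α ℤ.+ + 8)) where

  squareFree⇒≢0 : ∀ {n} → SquareFree n → n ≢ + 0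
  squareFree⇒≢0 sf refl = sf 2 (from-yes (prime? 2)) (4 ℕ.∣0)

  α²≢64 : α ℤ.* α ≢ + 64
  α²≢64 α²≡64 with ℤ.i*j≡0⇒i≡0∨j≡0 (α ℤ.- + 8) {α ℤ.+ + 8} (trans
    (solve 1 (λ α → (α :- con (+ 8)) :* (α :+ con (+ 8)) := α :* α :- con (+ 64)) refl α) (cong (ℤ._- + 64) α²≡64))
    where open ℤ.+-*-Solver
  ... | inj₁ α-8≡0 = squareFree⇒≢0 sf₋ α-8≡0
  ... | inj₂ α+8≡0 = squareFree⇒≢0 sf₊ α+8≡0

  fℤ : List ℤ
  fℤ = ℤ.- (+ 3) ∷ ℤ.- α ∷ ℤ.- (+ 6) ∷ + 0 ∷ + 1 ∷ []

  -- At the divisors of 3, f(1) = -(α + 8), f(-1) = α - 8, f(3) = -3 (α - 8) and f(-3) = 3 (α + 8),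
  -- while a squarefree integer is nonzero.
  no-integer-root : ∀ z → evalAt ℤ.+-*-commutativeRing id fℤ z ≢ + 0
  no-integer-root z zroot = contradict (divisor-of-3 z _ zroot) zroot
    where
    open ℤ.+-*-Solver
    value : ℤ → ℤ
    value = evalAt ℤ.+-*-commutativeRing id fℤ
    :value : ∀ {n} → Polynomial n → Polynomial n → Polynomial n
    :value α z = con (ℤ.- (+ 3)) :+ z :* (:- α :+ z :* (con (ℤ.- (+ 6)) :+ z :* (con (+ 0) :+ z :* (con (+ 1) :+ z :* con (+ 0)))))
    contradict : ∀ {z} → (z ≡ + 1 ⊎ z ≡ ℤ.- (+ 1)) ⊎ (z ≡ + 3 ⊎ z ≡ ℤ.- (+ 3)) → value z ≢ + 0
    contradict (inj₁ (inj₁ refl)) eq = squareFree⇒≢0 sf₊ (trans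
      (solve 1 (λ α → α :+ con (+ 8) := :- :value α (con (+ 1))) refl α) (cong ℤ.-_ eq))
    contradict (inj₁ (inj₂ refl)) eq = squareFree⇒≢0 sf₋ (trans
      (solve 1 (λ α → α :- con (+ 8) := :value α (con (ℤ.- (+ 1)))) refl α) eq)
    contradict (inj₂ (inj₁ refl)) eq = squareFree⇒≢0 sf₋ (ℤ.*-cancelˡ-≡ (ℤ.- (+ 3)) _ (+ 0) (trans
      (solve 1 (λ α → con (ℤ.- (+ 3)) :* (α :- con (+ 8)) := :value α (con (+ 3))) refl α) eq))
    contradict (inj₂ (inj₂ refl)) eq = squareFree⇒≢0 sf₊ (ℤ.*-cancelˡ-≡ (+ 3) _ (+ 0) (trans
      (solve 1 (λ α → con (+ 3) :* (α :+ con (+ 8)) := :value α (con (ℤ.- (+ 3)))) refl α) eq))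
 

  no-root : ∀ r → evaluationAt r (fα α) ≢ 0ℚ
  no-root r root = no-integer-root z
    (integer-root fℤ z (subst (λ r → evalAt ℚ.+-*-commutativeRing ℤ→ℚ fℤ r ≡ 0ℚ) (proj₂ r-integer) root))
    where
    r-integer : ∃[ z ] r ≡ ℤ→ℚ z
    r-integer = integral⇒integer r (ℤ.- (+ 3) ∷ ℤ.- α ∷ ℤ.- (+ 6) ∷ + 0 ∷ []) root
    z = proj₁ r-integer

  -- Rests on t³ - 12 t² + 48 t = (t - 4)³ + 64, with t standing for a².
  squares⇒α²≡64 : ∀ t → t ≡ + 4 → ℤ.- (ℤ.- α ℤ.* ℤ.- α) ℤ.+ t ℤ.* (+ 48 ℤ.+ t ℤ.* (ℤ.- (+ 12) ℤ.+ t)) ≡ + 0 → α ℤ.* α ≡ + 64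
  squares⇒α²≡64 .(+ 4) refl eq = trans
    (solve 1 (λ α → α :* α :=
      con (+ 64) :- (:- (:- α :* :- α) :+ con (+ 4) :* (con (+ 48) :+ con (+ 4) :* (con (ℤ.- (+ 12)) :+ con (+ 4))))) refl α)
    (cong (ℤ._-_ (+ 64)) eq)
    where open ℤ.+-*-Solver

  -- (X² − 4)³ − (α² − 64), which vanishes at a if T² + aT + b divides f.
  resolvent : List ℤ
  resolvent = ℤ.- (ℤ.- α ℤ.* ℤ.- α) ∷ + 0 ∷ + 48 ∷ + 0 ∷ ℤ.- (+ 12) ∷ + 0 ∷ []

  -- The candidates b = 1 and b = -3 force a² = 4, where the resolvent gives α² = 64; b = -1 and b =
  -- 3 force a² = 8.
  no-integer-quadratic : ∀ a b → evalAt ℤ.+-*-commutativeRing id (resolvent ++ [ + 1 ]) a ≡ + 0 →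
    evalAt ℤ.+-*-commutativeRing id (ℤ.- (+ 3) ∷ + 6 ℤ.- a ℤ.* a ∷ + 1 ∷ []) b ≢ + 0
  no-integer-quadratic a b a-root b-root = contradict (divisor-of-3 b _ b-root) b-root
    where
    open ℤ.+-*-Solver
    a²≢4 : a ℤ.* a ≢ + 4
    a²≢4 a²≡4 = α²≢64 (squares⇒α²≡64 (a ℤ.* a) a²≡4 (trans
      (solve 2 (λ α a → :- (:- α :* :- α) :+ a :* a :* (con (+ 48) :+ a :* a :* (con (ℤ.- (+ 12)) :+ a :* a)) :=
        :- (:- α :* :- α) :+ a :* (con (+ 0) :+ a :* (con (+ 48) :+ a :* (con (+ 0) :+ a :* (con (ℤ.- (+ 12)) :+
          a :* (con (+ 0) :+ a :* (con (+ 1) :+ a :* con (+ 0)))))))) refl α a) a-root))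
    value : ℤ → ℤ
    value = evalAt ℤ.+-*-commutativeRing id (ℤ.- (+ 3) ∷ + 6 ℤ.- a ℤ.* a ∷ + 1 ∷ [])
    :value : ∀ {n} → Polynomial n → Polynomial n → Polynomial n
    :value a b = con (ℤ.- (+ 3)) :+ b :* ((con (+ 6) :- a :* a) :+ b :* (con (+ 1) :+ b :* con (+ 0)))
    contradict : ∀ {b} → (b ≡ + 1 ⊎ b ≡ ℤ.- (+ 1)) ⊎ (b ≡ + 3 ⊎ b ≡ ℤ.- (+ 3)) → value b ≢ + 0
    contradict (inj₁ (inj₁ refl)) eq = a²≢4 (trans
      (solve 1 (λ a → a :* a := con (+ 4) :- :value a (con (+ 1))) refl a) (cong (ℤ._-_ (+ 4)) eq))
    contradict (inj₁ (inj₂ refl)) eq = square≢8 a (trans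
      (solve 1 (λ a → a :* a := con (+ 8) :+ :value a (con (ℤ.- (+ 1)))) refl a) (cong (ℤ._+_ (+ 8)) eq))
    contradict (inj₂ (inj₁ refl)) eq = square≢8 a (ℤ.*-cancelˡ-≡ (+ 3) _ (+ 8) (trans
      (solve 1 (λ a → con (+ 3) :* (a :* a) := con (+ 24) :- :value a (con (+ 3))) refl a) (cong (ℤ._-_ (+ 24)) eq)))
    contradict (inj₂ (inj₂ refl)) eq = a²≢4 (ℤ.*-cancelˡ-≡ (+ 3) _ (+ 4) (trans
      (solve 1 (λ a → con (+ 3) :* (a :* a) := con (+ 12) :+ :value a (con (ℤ.- (+ 3)))) refl a) (cong (ℤ._+_ (+ 12)) eq)))

  -- Integrality is obtained in two stages: a is a root of the monic `resolvent`, and only once a is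
  -- an integer does b satisfy a monic quadratic equation over ℤ, with middle coefficient 6 - a².
  no-quadratic : ∀ a b → b ℚ.* (a ℚ.* a ℚ.+ ℤ→ℚ (ℤ.- (+ 6)) ℚ.- b) ≡ ℤ→ℚ (ℤ.- (+ 3)) →
    a ℚ.* (a ℚ.* a ℚ.+ ℤ→ℚ (ℤ.- (+ 6)) ℚ.- b ℚ.- b) ≢ ℤ→ℚ (ℤ.- α)
  no-quadratic a b constant linear = no-integer-quadratic A B
      (integer-root (resolvent ++ [ + 1 ]) A (subst (λ a → evalAt ℚ.+-*-commutativeRing ℤ→ℚ (resolvent ++ [ + 1 ]) a ≡ 0ℚ) a≡A a-root))
      (integer-root (ℤ.- (+ 3) ∷ + 6 ℤ.- A ℤ.* A ∷ + 1 ∷ []) B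
        (subst (λ b → evalAt ℚ.+-*-commutativeRing ℤ→ℚ (ℤ.- (+ 3) ∷ + 6 ℤ.- A ℤ.* A ∷ + 1 ∷ []) b ≡ 0ℚ) b≡B b-root))
    where
    open ≡-Reasoning
    open ℚ-Solver
    s = a ℚ.* a ℚ.+ ℤ→ℚ (ℤ.- (+ 6))
    c = b ℚ.* (s ℚ.- b)
    l = a ℚ.* (s ℚ.- b ℚ.- b)
    sextic : ℚ → ℚ
    sextic x = x ℚ.+ a ℚ.* (0ℚ ℚ.+ a ℚ.* (ℤ→ℚ (+ 48) ℚ.+ a ℚ.* (0ℚ ℚ.+ a ℚ.*
      (ℤ→ℚ (ℤ.- (+ 12)) ℚ.+ a ℚ.* (0ℚ ℚ.+ a ℚ.* (1ℚ ℚ.+ a ℚ.* 0ℚ))))))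
    a-root : evalAt ℚ.+-*-commutativeRing ℤ→ℚ (resolvent ++ [ + 1 ]) a ≡ 0ℚ
    a-root = begin
      sextic (ℤ→ℚ (ℤ.- (ℤ.- α ℤ.* ℤ.- α)))
        ≡⟨ cong sextic (trans (ℤ→ℚ-homo-neg (ℤ.- α ℤ.* ℤ.- α)) (cong ℚ.-_ (ℤ→ℚ-homo-* (ℤ.- α) (ℤ.- α)))) ⟩
      sextic (ℚ.- (ℤ→ℚ (ℤ.- α) ℚ.* ℤ→ℚ (ℤ.- α)))
        ≡⟨ cong (λ x → sextic (ℚ.- (x ℚ.* x))) (sym linear) ⟩
      sextic (ℚ.- (l ℚ.* l))
        -- Elimination of b: l² = a² (s - 2b)² = a² (s² - 4c) with s = a² - 6, and for c = -3 this
        -- equals (a² - 4)³ + 64.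
        ≡⟨ solve 2 (λ a b →
             let s = a :* a :+ con (ℤ.- (+ 6))
                 l = a :* (s :- b :- b)
             in :- (l :* l) :+ a :* (con (+ 0) :+ a :* (con (+ 48) :+ a :* (con (+ 0) :+ a :* (con (ℤ.- (+ 12)) :+
                  a :* (con (+ 0) :+ a :* (con (+ 1) :+ a :* con (+ 0))))))) :=
                con (+ 4) :* a :* a :* (b :* (s :- b) :- con (ℤ.- (+ 3)))) refl a b ⟩
      ℤ→ℚ (+ 4) ℚ.* a ℚ.* a ℚ.* (c ℚ.- ℤ→ℚ (ℤ.- (+ 3)))
        ≡⟨ cong (λ x → ℤ→ℚ (+ 4) ℚ.* a ℚ.* a ℚ.* (x ℚ.- ℤ→ℚ (ℤ.- (+ 3)))) constant ⟩
      ℤ→ℚ (+ 4) ℚ.* a ℚ.* a ℚ.* 0ℚ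
        ≡⟨ ℚ.*-zeroʳ (ℤ→ℚ (+ 4) ℚ.* a ℚ.* a) ⟩
      0ℚ ∎
    a-integer : ∃[ z ] a ≡ ℤ→ℚ z
    a-integer = integral⇒integer a resolvent a-root
    A = proj₁ a-integer
    a≡A = proj₂ a-integer
    coefficient≡ : ℤ→ℚ (+ 6 ℤ.- A ℤ.* A) ≡ ℤ→ℚ (+ 6) ℚ.- a ℚ.* a
    coefficient≡ = begin
      ℤ→ℚ (+ 6 ℤ.- A ℤ.* A)                  ≡⟨ ℤ→ℚ-homo-+ (+ 6) (ℤ.- (A ℤ.* A)) ⟩
      ℤ→ℚ (+ 6) ℚ.+ ℤ→ℚ (ℤ.- (A ℤ.* A))      ≡⟨ cong (ℤ→ℚ (+ 6) ℚ.+_) (trans (ℤ→ℚ-homo-neg (A ℤ.* A)) (cong ℚ.-_ (ℤ→ℚ-homo-* A A))) ⟩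
      ℤ→ℚ (+ 6) ℚ.- ℤ→ℚ A ℚ.* ℤ→ℚ A          ≡⟨ cong (λ x → ℤ→ℚ (+ 6) ℚ.- x ℚ.* x) a≡A ⟨
      ℤ→ℚ (+ 6) ℚ.- a ℚ.* a                  ∎
    b-root : evalAt ℚ.+-*-commutativeRing ℤ→ℚ ((ℤ.- (+ 3) ∷ + 6 ℤ.- A ℤ.* A ∷ []) ++ [ + 1 ]) b ≡ 0ℚ
    b-root = begin
      ℤ→ℚ (ℤ.- (+ 3)) ℚ.+ b ℚ.* (ℤ→ℚ (+ 6 ℤ.- A ℤ.* A) ℚ.+ b ℚ.* (1ℚ ℚ.+ b ℚ.* 0ℚ))
        ≡⟨ cong (λ x → ℤ→ℚ (ℤ.- (+ 3)) ℚ.+ b ℚ.* (x ℚ.+ b ℚ.* (1ℚ ℚ.+ b ℚ.* 0ℚ))) coefficient≡ ⟩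
      ℤ→ℚ (ℤ.- (+ 3)) ℚ.+ b ℚ.* (ℤ→ℚ (+ 6) ℚ.- a ℚ.* a ℚ.+ b ℚ.* (1ℚ ℚ.+ b ℚ.* 0ℚ))
        ≡⟨ solve 2 (λ a b → con (ℤ.- (+ 3)) :+ b :* (con (+ 6) :- a :* a :+ b :* (con (+ 1) :+ b :* con (+ 0))) :=
             con (ℤ.- (+ 3)) :- b :* (a :* a :+ con (ℤ.- (+ 6)) :- b)) refl a b ⟩
      ℤ→ℚ (ℤ.- (+ 3)) ℚ.- c
        ≡⟨ cong (λ x → ℤ→ℚ (ℤ.- (+ 3)) ℚ.- x) constant ⟩
      0ℚ ∎
    b-integer : ∃[ z ] b ≡ ℤ→ℚ z
    b-integer = integral⇒integer b (ℤ.- (+ 3) ∷ + 6 ℤ.- A ℤ.* A ∷ []) b-root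
    B = proj₁ b-integer
    b≡B = proj₂ b-integer

  f-vanishes : VanishesAbove 4 (coeff (fα α))
  f-vanishes (suc (suc (suc (suc (suc k))))) _ = refl
  f-vanishes 1 (ℕ.s≤s ())
  f-vanishes 2 (ℕ.s≤s (ℕ.s≤s ()))
  f-vanishes 3 (ℕ.s≤s (ℕ.s≤s (ℕ.s≤s ())))
  f-vanishes 4 (ℕ.s≤s (ℕ.s≤s (ℕ.s≤s (ℕ.s≤s ()))))

  no-root-factor : ∀ r g h → fα α ≈ₚ (g *ₚ h) → evaluationAt r g ≢ 0ℚ × evaluationAt r h ≢ 0ℚ
  no-root-factor r g h f≈gh =
    (λ g≡0 → no-root r (trans f[r]≡ (trans (cong (ℚ._* evaluationAt r h) g≡0) (ℚ.*-zeroˡ (evaluationAt r h)))))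
    , (λ h≡0 → no-root r (trans f[r]≡ (trans (cong (evaluationAt r g ℚ.*_) h≡0) (ℚ.*-zeroʳ (evaluationAt r g)))))
    where
    open Evaluation ℚ.+-*-commutativeRing (Identity.isRingHomomorphism ℚ.+-*-rawRing refl) r
    f[r]≡ : evaluationAt r (fα α) ≡ evaluationAt r g ℚ.* evaluationAt r h
    f[r]≡ = trans (evalₚ-cong (fα α) (g *ₚ h) f≈gh) (evalₚ-*ₚ g h)

  no-linear-factorˡ : ∀ g h → fα α ≈ₚ (g *ₚ h) → coeff g 1 ≢ 0ℚ → ¬ VanishesAbove 1 (coeff g)
  no-linear-factorˡ g h f≈gh g₁≢0 vanishes = let r , g[r]≡0 = linear⇒root g g₁≢0 vanishes in
    proj₁ (no-root-factor r g h f≈gh) g[r]≡0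

  no-linear-factorʳ : ∀ g h → fα α ≈ₚ (g *ₚ h) → coeff h 1 ≢ 0ℚ → ¬ VanishesAbove 1 (coeff h)
  no-linear-factorʳ g h f≈gh h₁≢0 vanishes = let r , h[r]≡0 = linear⇒root h h₁≢0 vanishes in
    proj₂ (no-root-factor r g h f≈gh) h[r]≡0

  no-quadratic-factor : ∀ g h → fα α ≈ₚ (g *ₚ h) → VanishesAbove 2 (coeff g) → ¬ VanishesAbove 2 (coeff h)
  no-quadratic-factor g h f≈gh g-deg h-deg = no-quadratic a b
      (subst₂ (λ x y → b ℚ.* (a ℚ.* a ℚ.+ x ℚ.- b) ≡ y) f₂≡ (sym (f≡ 0)) constant-term)
      (subst₂ (λ x y → a ℚ.* (a ℚ.* a ℚ.+ x ℚ.- b ℚ.- b) ≡ y) f₂≡ (sym (f≡ 1)) linear-term)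
    where
    P = coeff g
    Q = coeff h
    f≡ : ∀ k → coeff (fα α) k ≡ convolve P Q k
    f≡ k = trans (f≈gh k) (coeff-*ₚ g h k)
    cubic : P 1 ℚ.* Q 2 ℚ.+ P 2 ℚ.* Q 1 ≡ 0ℚ
    cubic = begin
      P 1 ℚ.* Q 2 ℚ.+ P 2 ℚ.* Q 1
        ≡⟨ solve 6 (λ p₀ p₁ p₂ q₀ q₁ q₂ → p₁ :* q₂ :+ p₂ :* q₁ := p₀ :* con (+ 0) :+ (p₁ :* q₂ :+ (p₂ :* q₁ :+ con (+ 0) :* q₀))) refl
             (P 0) (P 1) (P 2) (Q 0) (Q 1) (Q 2) ⟩
      P 0 ℚ.* 0ℚ ℚ.+ (P 1 ℚ.* Q 2 ℚ.+ (P 2 ℚ.* Q 1 ℚ.+ 0ℚ ℚ.* Q 0))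
        ≡⟨ cong₂ (λ p₃ q₃ → P 0 ℚ.* q₃ ℚ.+ (P 1 ℚ.* Q 2 ℚ.+ (P 2 ℚ.* Q 1 ℚ.+ p₃ ℚ.* Q 0))) (g-deg 3 ℕ.≤-refl) (h-deg 3 ℕ.≤-refl) ⟨
      convolve P Q 3
        ≡⟨ f≡ 3 ⟨
      0ℚ ∎
      where
      open ≡-Reasoning
      open ℚ-Solver
    open QuadraticFactor {P 0} {P 1} {P 2} {Q 0} {Q 1} {Q 2} cubic (sym (trans (f≡ 4) (convolve-top 2 2 P Q g-deg h-deg)))
    f₂≡ : f₂ ≡ ℤ→ℚ (ℤ.- (+ 6))
    f₂≡ = trans (ℚ.+-assoc (P 0 ℚ.* Q 2) (P 1 ℚ.* Q 1) (P 2 ℚ.* Q 0)) (sym (f≡ 2))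

  degree-sum≤4 : ∀ g h {d e} → fα α ≈ₚ (g *ₚ h) → coeff g d ≢ 0ℚ → coeff h e ≢ 0ℚ →
    VanishesAbove d (coeff g) → VanishesAbove e (coeff h) → ¬ 4 ℕ.< d ℕ.+ e
  degree-sum≤4 g h {d} {e} f≈gh g≢0 h≢0 g-deg h-deg 4<d+e = *-≢0 g≢0 h≢0 (begin
    coeff g d ℚ.* coeff h e                       ≡⟨ convolve-top d e (coeff g) (coeff h) g-deg h-deg ⟨
    convolve (coeff g) (coeff h) (d ℕ.+ e)        ≡⟨ coeff-*ₚ g h (d ℕ.+ e) ⟨
    coeff (g *ₚ h) (d ℕ.+ e)                      ≡⟨ f≈gh (d ℕ.+ e) ⟨
    coeff (fα α) (d ℕ.+ e)                        ≡⟨ f-vanishes (d ℕ.+ e) 4<d+e ⟩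
    0ℚ                                            ∎)
    where open ≡-Reasoning

  -- When both degrees are at least 2, either both equal 2 or their sum exceeds 4, so smaller sums
  -- need no separate case.
  factor-constant : ∀ g h → fα α ≈ₚ (g *ₚ h) → Degree g → Degree h → ¬ NonConstant g ⊎ ¬ NonConstant h
  factor-constant g h f≈gh (zero-poly g≡0)          _                        = inj₁ λ (k , g≢0) → g≢0 (g≡0 (suc k))
  factor-constant g h f≈gh (degree 0 _ g-deg)       _                        = inj₁ λ (k , g≢0) → g≢0 (g-deg (suc k) (ℕ.s≤s ℕ.z≤n))
  factor-constant g h f≈gh _                        (zero-poly h≡0)          = inj₂ λ (k , h≢0) → h≢0 (h≡0 (suc k))
  factor-constant g h f≈gh _                        (degree 0 _ h-deg)       = inj₂ λ (k , h≢0) → h≢0 (h-deg (suc k) (ℕ.s≤s ℕ.z≤n))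
  factor-constant g h f≈gh (degree 1 g₁≢0 g-deg)    _                        = ⊥-elim (no-linear-factorˡ g h f≈gh g₁≢0 g-deg)
  factor-constant g h f≈gh _                        (degree 1 h₁≢0 h-deg)    = ⊥-elim (no-linear-factorʳ g h f≈gh h₁≢0 h-deg)
  factor-constant g h f≈gh (degree 2 _ g-deg)       (degree 2 _ h-deg)       = ⊥-elim (no-quadratic-factor g h f≈gh g-deg h-deg)
  factor-constant g h f≈gh (degree (suc (suc (suc d))) g≢0 g-deg) (degree (suc (suc e)) h≢0 h-deg) =
    ⊥-elim (degree-sum≤4 g h f≈gh g≢0 h≢0 g-deg h-deg (ℕ.+-mono-≤ {3} {3 ℕ.+ d} {2} {2 ℕ.+ e} (ℕ.m≤m+n 3 d) (ℕ.m≤m+n 2 e)))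
  factor-constant g h f≈gh (degree 2 g≢0 g-deg) (degree (suc (suc (suc e))) h≢0 h-deg) =
    ⊥-elim (degree-sum≤4 g h f≈gh g≢0 h≢0 g-deg h-deg (ℕ.+-mono-≤ {2} {2} {3} {3 ℕ.+ e} ℕ.≤-refl (ℕ.m≤m+n 3 e)))

  irreducible : IrreducibleOverℚ (fα α)
  irreducible = (λ f≡0 → 1≢0 (f≡0 4)) , (3 , 1≢0) , (λ g h f≈gh → factor-constant g h f≈gh (findDegree g) (findDegree h))
    where
    1≢0 : 1ℚ ≢ 0ℚ
    1≢0 ()

open import Data.Integer using (_-_; _+_)

theorem1p1 : (α : ℤ) → SquareFree (α - + 8) → SquareFree (α + + 8) →
    IrreducibleOverℚ (fα α) × RingOfIntegersIsℤ[θ] (fα α)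
theorem1p1 α sf₋ sf₊ = Irreducible.irreducible α sf₋ sf₊ , Integers.ringOfIntegers α sf₋ sf₊
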